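{- Let $\mathsf{ALR}_{\mathbb{K}}$ (resp. $\mathsf{LR}_{\mathbb{K}}$) be the $\dagger$-compact prop of affine (resp. linear) Lagrangian relations and $\mathsf{ACR}_{\mathbb{K}}$ (resp. $\mathsf{CR}_{\mathbb{K}}$) the $\dagger$-compact prop of affine (resp. linear) coisotropic relations over a field $\mathbb{K}$. Then the discard construction $\mathsf{ALR}_{\mathbb{K}}^{\mathrm{disc}}$ is isomorphic to $\mathsf{ACR}_{\mathbb{K}}$, via the prop morphism which is the inclusion on arrows of $\mathsf{ALR}_{\mathbb{K}}$ and sends the added generator $d:1\to 0$ to the relation $\mathbb{K}^2\times\{\bullet\}=\{(v,\bullet): v\in\mathbb{K}^2\}:1\to 0$. Likewise $\mathsf{LR}_{\mathbb{K}}^{\mathrm{disc}}\cong\mathsf{CR}_{\mathbb{K}}$ via the analogous morphism.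
   Context: $\mathbb{K}$ is an arbitrary field. For $n\in\mathbb{N}$, $\mathbb{K}^{2n}=\bigoplus_{j=0}^{n-1}\mathbb{K}^2$ with coordinates $(z_j,x_j)$ carries $\omega_n\big(\bigoplus_j (z_j,x_j),\bigoplus_j(z'_j,x'_j)\big)=\sum_j (z_jx'_j-x_jz'_j)$. A relation $n\to m$ is a subset of $\mathbb{K}^{2n}\oplus\mathbb{K}^{2m}$, given the symplectic form $((v,w),(v',w'))\mapsto \omega_n(v,v')-\omega_m(w,w')$. For a linear subspace $S$, $S^\omega=\{v:\omega(v,s)=0\ \forall s\in S\}$; $S$ is coisotropic if $S^\omega\subseteq S$ and Lagrangian if $S=S^\omega$. An affine subspace (possibly empty) is coisotropic/Lagrangian if it is empty or its underlying linear subspace is; linear relations are required nonempty linear subspaces. The props $\mathsf{ALR}_\mathbb{K},\mathsf{LR}_\mathbb{K},\mathsf{ACR}_\mathbb{K},\mathsf{CR}_\mathbb{K}$ have objects $n\in\mathbb{N}$, arrows $n\to m$ the affine Lagrangian / linear Lagrangian / affine coisotropic / linear coisotropic relations $n\to m$, relational composition, monoidal product the direct sum, symmetry swapping the $\mathbb{K}^2$ blocks, compact structure $\eta_1=\{(\bullet,(z,x,z,-x))\}$, $\epsilon_1=\{((z,x,z,-x),\bullet)\}$, and dagger $R^\dagger=\{(\bigoplus_j(z_j,-x_j),\bigoplus_k(z'_k,-x'_k)) : (\bigoplus_k(z'_k,x'_k),\bigoplus_j(z_j,x_j))\in R\}$. In a $\dagger$-compact prop, $H:n\to m$ is an isometry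 if $H^\dagger\circ H=\mathrm{id}_n$. For a $\dagger$-compact prop $\mathsf{C}$, the discard construction $\mathsf{C}^{\mathrm{disc}}$ is the prop obtained by freely adjoining to $\mathsf{C}$ a generator $d:1\to 0$ subject to the equations $d^{\otimes m}\circ H=d^{\otimes n}$ for every isometry $H:n\to m$ of $\mathsf{C}$ (with $d^{\otimes 0}=\mathrm{id}_0$).
   Formalization: The dagger is taken to be the plain relational converse R†={(w,v):(v,w)∈R}, without the sign changes x↦−x; with the signs the claim fails when the characteristic is not 2 (the shear (z,x)↦(z+x,x) is then no isometry, so d∘s≠d), and in characteristic 2 the two daggers agree. -}

module Defs where

open import Level using (_⊔_; suc; Lift; lift)
open import Algebra.Bundles using (CommutativeRing)
open import Algebra.Solver.Ring.AlmostCommutativeRing using (_-Raw-AlmostCommutative⟶_; fromCommutativeRing)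
open import Axiom.ExcludedMiddle using (ExcludedMiddle)
open import Data.Integer.Base as ℤ using (ℤ; +_; -[1+_])
import Data.Maybe.Base as Maybe
open import Data.Nat.Base as ℕ using (ℕ; zero; _+_)
open import Data.Nat.Properties using (+-assoc; +-identityʳ; +-suc)
open import Data.Product.Base using (Σ; Σ-syntax; ∃-syntax; _×_; _,_; proj₁; proj₂; swap)
open import Data.Product.Relation.Binary.Pointwise.NonDependent using (×-setoid)
import Data.Sign.Base as Sign
open import Data.Sum.Base using (_⊎_; inj₁; inj₂)
open import Data.Unit.Polymorphic.Base using (⊤; tt)
open import Data.Vec.Base using (Vec; []; _∷_; _++_; map; zipWith; replicate; take; drop)
open import Data.Vec.Properties using (take-zipWith; drop-zipWith; take-map; drop-map)
open import Function.Base using (_∘′_)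
open import Relation.Binary.Core using (Rel)
open import Relation.Binary.Structures using (IsEquivalence)
open import Relation.Binary.PropositionalEquality.Core as ≡ using (_≡_; subst; subst₂)
open import Relation.Nullary.Decidable.Core using (Dec; yes; no; dec⇒maybe)
open import Relation.Nullary.Negation.Core using (¬_; contradiction)
import Algebra.Properties.Ring
import Algebra.Properties.Semiring.Mult.TCOptimised
import Algebra.Solver.Ring
import Data.Integer.Properties as ℤ
import Data.Vec.Relation.Binary.Equality.Setoid as VecEquality
import Relation.Binary.Reasoning.Setoid

------------------------------------------------------------------------
-- Fields

record Field c ℓ : Set (suc (c ⊔ ℓ)) where
  field
    commutativeRing : CommutativeRing c ℓ

  open CommutativeRing commutativeRing public

  field
    1≉0     : ¬ (1# ≈ 0#)
    inverse : ∀ x → ¬ (x ≈ 0#) → ∃[ y ] x * y ≈ 1#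

------------------------------------------------------------------------
-- Props: strict symmetric monoidal categories whose objects are the
-- natural numbers, with addition as tensor product.  Homs are setoids.
-- Since addition is strictly associative and unital only up to _≡_, the
-- equations of strictness are stated after transport of the arrows.

record PROP o e : Set (suc (o ⊔ e)) where
  infix  4 _≈_
  infixr 9 _∘_
  infixr 10 _⊗_
  field
    Hom : ℕ → ℕ → Set o
    _≈_ : ∀ {n m} → Rel (Hom n m) e
    id  : ∀ n → Hom n n
    _∘_ : ∀ {n m k} → Hom m k → Hom n m → Hom n k
    _⊗_ : ∀ {n m n′ m′} → Hom n m → Hom n′ m′ → Hom (n + n′) (m + m′)
    σ   : ∀ n m → Hom (n + m) (m + n)

  cast : ∀ {n n′ m m′} → n ≡ n′ → m ≡ m′ → Hom n m → Hom n′ m′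
  cast = subst₂ Hom

  field
    isEquivalence : ∀ {n m} → IsEquivalence (_≈_ {n} {m})

    ∘-cong    : ∀ {n m k} {f f′ : Hom m k} {g g′ : Hom n m} →
                f ≈ f′ → g ≈ g′ → f ∘ g ≈ f′ ∘ g′
    identityˡ : ∀ {n m} (f : Hom n m) → id m ∘ f ≈ f
    identityʳ : ∀ {n m} (f : Hom n m) → f ∘ id n ≈ f
    assoc     : ∀ {n m k l} (f : Hom k l) (g : Hom m k) (h : Hom n m) →
                (f ∘ g) ∘ h ≈ f ∘ (g ∘ h)

    ⊗-cong      : ∀ {n m n′ m′} {f g : Hom n m} {f′ g′ : Hom n′ m′} →
                  f ≈ g → f′ ≈ g′ → f ⊗ f′ ≈ g ⊗ g′
    ⊗-id        : ∀ n m → id n ⊗ id m ≈ id (n + m)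
    interchange : ∀ {n m k n′ m′ k′} (f : Hom m k) (g : Hom n m)
                  (f′ : Hom m′ k′) (g′ : Hom n′ m′) →
                  (f ∘ g) ⊗ (f′ ∘ g′) ≈ (f ⊗ f′) ∘ (g ⊗ g′)

    ⊗-assoc     : ∀ {n m n′ m′ n″ m″} (f : Hom n m) (g : Hom n′ m′) (h : Hom n″ m″) →
                  cast (+-assoc n n′ n″) (+-assoc m m′ m″) ((f ⊗ g) ⊗ h) ≈ f ⊗ (g ⊗ h)
    ⊗-identityˡ : ∀ {n m} (f : Hom n m) → id 0 ⊗ f ≈ f
    ⊗-identityʳ : ∀ {n m} (f : Hom n m) →
                  cast (+-identityʳ n) (+-identityʳ m) (f ⊗ id 0) ≈ f

    σ-natural    : ∀ {n m n′ m′} (f : Hom n m) (g : Hom n′ m′) →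
                   σ m m′ ∘ (f ⊗ g) ≈ (g ⊗ f) ∘ σ n n′
    σ-involutive : ∀ n m → σ m n ∘ σ n m ≈ id (n + m)
    σ-hexagon    : ∀ n m k →
                   σ n (m + k) ≈
                   cast (+-assoc n m k) (≡.sym (+-assoc m k n))
                     ((id m ⊗ σ n k) ∘ cast ≡.refl (+-assoc m n k) (σ n m ⊗ id k))

-- A compact structure on the generating object 1, with 1 its own dual,
-- determines one on every object.

record DaggerCompactPROP o e : Set (suc (o ⊔ e)) where
  infix 11 _†
  field
    prop : PROP o e

  open PROP prop public

  field
    _†           : ∀ {n m} → Hom n m → Hom m n
    †-cong       : ∀ {n m} {f g : Hom n m} → f ≈ g → f † ≈ g †
    †-involutive : ∀ {n m} (f : Hom n m) → (f †) † ≈ f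
    †-id         : ∀ n → id n † ≈ id n
    †-∘          : ∀ {n m k} (f : Hom m k) (g : Hom n m) → (f ∘ g) † ≈ g † ∘ f †
    †-⊗          : ∀ {n m n′ m′} (f : Hom n m) (g : Hom n′ m′) → (f ⊗ g) † ≈ f † ⊗ g †
    †-σ          : ∀ n m → σ n m † ≈ σ m n

    η₁     : Hom 0 2
    ε₁     : Hom 2 0
    snakeˡ : (ε₁ ⊗ id 1) ∘ (id 1 ⊗ η₁) ≈ id 1
    snakeʳ : (id 1 ⊗ ε₁) ∘ (η₁ ⊗ id 1) ≈ id 1
    ε₁≈η₁† : ε₁ ≈ η₁ † ∘ σ 1 1

  IsIsometry : ∀ {n m} → Hom n m → Set e
  IsIsometry {n} H = H † ∘ H ≈ id n

record PROPMorphism {o e o′ e′} (C : PROP o e) (D : PROP o′ e′) : Set (o ⊔ e ⊔ o′ ⊔ e′) where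
  private
    module C = PROP C
    module D = PROP D
  field
    map-hom  : ∀ {n m} → C.Hom n m → D.Hom n m
    map-cong : ∀ {n m} {f g : C.Hom n m} → f C.≈ g → map-hom f D.≈ map-hom g
    map-id   : ∀ n → map-hom (C.id n) D.≈ D.id n
    map-∘    : ∀ {n m k} (f : C.Hom m k) (g : C.Hom n m) →
               map-hom (f C.∘ g) D.≈ map-hom f D.∘ map-hom g
    map-⊗    : ∀ {n m n′ m′} (f : C.Hom n m) (g : C.Hom n′ m′) →
               map-hom (f C.⊗ g) D.≈ map-hom f D.⊗ map-hom g
    map-σ    : ∀ n m → map-hom (C.σ n m) D.≈ D.σ n m

record IsIsomorphism {o e o′ e′} {C : PROP o e} {D : PROP o′ e′} (F : PROPMorphism C D) :
                     Set (o ⊔ e ⊔ o′ ⊔ e′) where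
  private
    module C = PROP C
    module D = PROP D
  open PROPMorphism F
  field
    inverse  : PROPMorphism D C
    inverseˡ : ∀ {n m} (f : C.Hom n m) → PROPMorphism.map-hom inverse (map-hom f) C.≈ f
    inverseʳ : ∀ {n m} (g : D.Hom n m) → map-hom (PROPMorphism.map-hom inverse g) D.≈ g

------------------------------------------------------------------------
-- The discard construction, by generators and relations.  The identities
-- and symmetries of the free prop are those of C, so that the equations
-- which involve only them are instances of arr-cong, arr-∘ and arr-⊗.

module Discard {o e} (C : DaggerCompactPROP o e) where
  private module C = DaggerCompactPROP C

  infix  4 _≈_
  infixr 9 _∘_
  infixr 10 _⊗_

  data Arrow : ℕ → ℕ → Set o where
    arr : ∀ {n m} → C.Hom n m → Arrow n m
    d   : Arrow 1 0
    _∘_ : ∀ {n m k} → Arrow m k → Arrow n m → Arrow n k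
    _⊗_ : ∀ {n m n′ m′} → Arrow n m → Arrow n′ m′ → Arrow (n + n′) (m + m′)

  d^⊗ : ∀ n → Arrow n 0
  d^⊗ zero      = arr (C.id 0)
  d^⊗ (ℕ.suc n) = d ⊗ d^⊗ n

  data _≈_ : ∀ {n m} → Arrow n m → Arrow n m → Set (o ⊔ e) where
    refl  : ∀ {n m} {f : Arrow n m} → f ≈ f
    sym   : ∀ {n m} {f g : Arrow n m} → f ≈ g → g ≈ f
    trans : ∀ {n m} {f g h : Arrow n m} → f ≈ g → g ≈ h → f ≈ h

    ∘-cong    : ∀ {n m k} {f f′ : Arrow m k} {g g′ : Arrow n m} →
                f ≈ f′ → g ≈ g′ → f ∘ g ≈ f′ ∘ g′
    identityˡ : ∀ {n m} (f : Arrow n m) → arr (C.id m) ∘ f ≈ f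
    identityʳ : ∀ {n m} (f : Arrow n m) → f ∘ arr (C.id n) ≈ f
    assoc     : ∀ {n m k l} (f : Arrow k l) (g : Arrow m k) (h : Arrow n m) →
                (f ∘ g) ∘ h ≈ f ∘ (g ∘ h)

    ⊗-cong      : ∀ {n m n′ m′} {f g : Arrow n m} {f′ g′ : Arrow n′ m′} →
                  f ≈ g → f′ ≈ g′ → f ⊗ f′ ≈ g ⊗ g′
    interchange : ∀ {n m k n′ m′ k′} (f : Arrow m k) (g : Arrow n m)
                  (f′ : Arrow m′ k′) (g′ : Arrow n′ m′) →
                  (f ∘ g) ⊗ (f′ ∘ g′) ≈ (f ⊗ f′) ∘ (g ⊗ g′)

    ⊗-assoc     : ∀ {n m n′ m′ n″ m″} (f : Arrow n m) (g : Arrow n′ m′) (h : Arrow n″ m″) →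
                  subst₂ Arrow (+-assoc n n′ n″) (+-assoc m m′ m″) ((f ⊗ g) ⊗ h) ≈ f ⊗ (g ⊗ h)
    ⊗-identityˡ : ∀ {n m} (f : Arrow n m) → arr (C.id 0) ⊗ f ≈ f
    ⊗-identityʳ : ∀ {n m} (f : Arrow n m) →
                  subst₂ Arrow (+-identityʳ n) (+-identityʳ m) (f ⊗ arr (C.id 0)) ≈ f

    σ-natural : ∀ {n m n′ m′} (f : Arrow n m) (g : Arrow n′ m′) →
                arr (C.σ m m′) ∘ (f ⊗ g) ≈ (g ⊗ f) ∘ arr (C.σ n n′)

    arr-cong : ∀ {n m} {f g : C.Hom n m} → f C.≈ g → arr f ≈ arr g
    arr-∘    : ∀ {n m k} (f : C.Hom m k) (g : C.Hom n m) → arr (f C.∘ g) ≈ arr f ∘ arr g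
    arr-⊗    : ∀ {n m n′ m′} (f : C.Hom n m) (g : C.Hom n′ m′) → arr (f C.⊗ g) ≈ arr f ⊗ arr g

    discard : ∀ {n m} (H : C.Hom n m) → C.IsIsometry H → d^⊗ m ∘ arr H ≈ d^⊗ n

  private
    arr-cast : ∀ {n n′ m m′} (p : n ≡ n′) (q : m ≡ m′) (f : C.Hom n m) →
               arr (C.cast p q f) ≈ subst₂ Arrow p q (arr f)
    arr-cast ≡.refl ≡.refl f = refl

    cast-cong : ∀ {n n′ m m′} (p : n ≡ n′) (q : m ≡ m′) {f g : Arrow n m} →
                f ≈ g → subst₂ Arrow p q f ≈ subst₂ Arrow p q g
    cast-cong ≡.refl ≡.refl f≈g = f≈g

  Disc : PROP o (o ⊔ e)
  Disc = record
    { Hom           = Arrow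
    ; _≈_           = _≈_
    ; id            = λ n → arr (C.id n)
    ; _∘_           = _∘_
    ; _⊗_           = _⊗_
    ; σ             = λ n m → arr (C.σ n m)
    ; isEquivalence = record { refl = refl ; sym = sym ; trans = trans }
    ; ∘-cong        = ∘-cong
    ; identityˡ     = identityˡ
    ; identityʳ     = identityʳ
    ; assoc         = assoc
    ; ⊗-cong        = ⊗-cong
    ; ⊗-id          = λ n m → trans (sym (arr-⊗ _ _)) (arr-cong (C.⊗-id n m))
    ; interchange   = interchange
    ; ⊗-assoc       = ⊗-assoc
    ; ⊗-identityˡ   = ⊗-identityˡ
    ; ⊗-identityʳ   = ⊗-identityʳ
    ; σ-natural     = σ-natural
    ; σ-involutive  = λ n m → trans (sym (arr-∘ _ _)) (arr-cong (C.σ-involutive n m))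
    ; σ-hexagon     = λ n m k →
        trans (arr-cong (C.σ-hexagon n m k))
        (trans (arr-cast _ _ _)
        (cast-cong (+-assoc n m k) (≡.sym (+-assoc m k n))
          (trans (arr-∘ _ _)
          (∘-cong (arr-⊗ _ _)
            (trans (arr-cast _ _ _)
            (cast-cong ≡.refl (+-assoc m n k) (arr-⊗ _ _)))))))
    }

open Discard using (Disc; arr; d) public

------------------------------------------------------------------------
-- Sub-props given by a class of arrows closed under all the operations

record IsSubPROP {o e} (C : DaggerCompactPROP o e) {p}
                 (P : ∀ {n m} → DaggerCompactPROP.Hom C n m → Set p) : Set (o ⊔ p) where
  open DaggerCompactPROP C
  field
    id-closed : ∀ n → P (id n)
    ∘-closed  : ∀ {n m k} {f : Hom m k} {g : Hom n m} → P f → P g → P (f ∘ g)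
    ⊗-closed  : ∀ {n m n′ m′} {f : Hom n m} {g : Hom n′ m′} → P f → P g → P (f ⊗ g)
    σ-closed  : ∀ n m → P (σ n m)
    †-closed  : ∀ {n m} {f : Hom n m} → P f → P (f †)
    η₁-closed : P η₁
    ε₁-closed : P ε₁

module _ {o e} (C : DaggerCompactPROP o e) {p}
         (P : ∀ {n m} → DaggerCompactPROP.Hom C n m → Set p) (sub : IsSubPROP C P) where
  open DaggerCompactPROP C
  open IsSubPROP sub

  private
    SubHom : ℕ → ℕ → Set (o ⊔ p)
    SubHom n m = Σ (Hom n m) P

    module E {n m} = IsEquivalence (isEquivalence {n} {m})

    proj₁-cast : ∀ {n n′ m m′} (q : n ≡ n′) (r : m ≡ m′) (f : SubHom n m) →
                 proj₁ (subst₂ SubHom q r f) ≈ cast q r (proj₁ f)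
    proj₁-cast ≡.refl ≡.refl f = E.refl

    cast-cong : ∀ {n n′ m m′} (q : n ≡ n′) (r : m ≡ m′) {f g : Hom n m} →
                f ≈ g → cast q r f ≈ cast q r g
    cast-cong ≡.refl ≡.refl f≈g = f≈g

  SubPROP : DaggerCompactPROP (o ⊔ p) e
  SubPROP = record
    { prop = record
      { Hom           = SubHom
      ; _≈_           = λ f g → proj₁ f ≈ proj₁ g
      ; id            = λ n → id n , id-closed n
      ; _∘_           = λ (f , Pf) (g , Pg) → f ∘ g , ∘-closed Pf Pg
      ; _⊗_           = λ (f , Pf) (g , Pg) → f ⊗ g , ⊗-closed Pf Pg
      ; σ             = λ n m → σ n m , σ-closed n m
      ; isEquivalence = record { refl = E.refl ; sym = E.sym ; trans = E.trans }
      ; ∘-cong        = ∘-cong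
      ; identityˡ     = λ (f , _) → identityˡ f
      ; identityʳ     = λ (f , _) → identityʳ f
      ; assoc         = λ (f , _) (g , _) (h , _) → assoc f g h
      ; ⊗-cong        = ⊗-cong
      ; ⊗-id          = ⊗-id
      ; interchange   = λ (f , _) (g , _) (f′ , _) (g′ , _) → interchange f g f′ g′
      ; ⊗-assoc       = λ {n} {m} {n′} {m′} {n″} {m″} (f , _) (g , _) (h , _) →
                        E.trans (proj₁-cast (+-assoc n n′ n″) (+-assoc m m′ m″) _) (⊗-assoc f g h)
      ; ⊗-identityˡ   = λ (f , _) → ⊗-identityˡ f
      ; ⊗-identityʳ   = λ {n} {m} (f , _) →
                        E.trans (proj₁-cast (+-identityʳ n) (+-identityʳ m) _) (⊗-identityʳ f)
      ; σ-natural     = λ (f , _) (g , _) → σ-natural f g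
      ; σ-involutive  = σ-involutive
      ; σ-hexagon     = λ n m k → E.trans (σ-hexagon n m k) (E.sym
          (E.trans (proj₁-cast (+-assoc n m k) (≡.sym (+-assoc m k n)) _)
          (cast-cong (+-assoc n m k) (≡.sym (+-assoc m k n))
            (∘-cong E.refl (proj₁-cast ≡.refl (+-assoc m n k) _)))))
      }
    ; _†           = λ (f , Pf) → f † , †-closed Pf
    ; †-cong       = †-cong
    ; †-involutive = λ (f , _) → †-involutive f
    ; †-id         = †-id
    ; †-∘          = λ (f , _) (g , _) → †-∘ f g
    ; †-⊗          = λ (f , _) (g , _) → †-⊗ f g
    ; †-σ          = †-σ
    ; η₁           = η₁ , η₁-closed
    ; ε₁           = ε₁ , ε₁-closed
    ; snakeˡ       = snakeˡ
    ; snakeʳ       = snakeʳ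
    ; ε₁≈η₁†       = ε₁≈η₁†
    }

------------------------------------------------------------------------
-- A solver for identities of commutative rings, with coefficients in ℤ

module RingSolver {c ℓ} (R : CommutativeRing c ℓ) where
  open CommutativeRing R renaming (_+_ to _+ᴷ_; +-assoc to +ᴷ-assoc; +-identityʳ to +ᴷ-identityʳ)
  private
    open Algebra.Properties.Ring ring
    open Algebra.Properties.Semiring.Mult.TCOptimised semiring renaming (_×_ to _×ᴺ_)
    open Relation.Binary.Reasoning.Setoid setoid

    ⟦_⟧ℤ : ℤ → Carrier
    ⟦ + n ⟧ℤ      = n ×ᴺ 1#
    ⟦ -[1+ n ] ⟧ℤ = - (ℕ.suc n ×ᴺ 1#)

    neg-homo : ∀ i → ⟦ ℤ.- i ⟧ℤ ≈ - ⟦ i ⟧ℤ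
    neg-homo (+ ℕ.zero)    = sym -0#≈0#
    neg-homo (+ (ℕ.suc n)) = refl
    neg-homo -[1+ n ]      = sym (-‿involutive _)

    ⊖-homo : ∀ m n → ⟦ m ℤ.⊖ n ⟧ℤ ≈ m ×ᴺ 1# - n ×ᴺ 1#
    ⊖-homo m         ℕ.zero    = sym (trans (+-congˡ -0#≈0#) (+ᴷ-identityʳ _))
    ⊖-homo ℕ.zero    (ℕ.suc n) = sym (+-identityˡ _)
    ⊖-homo (ℕ.suc m) (ℕ.suc n) = begin
      ⟦ ℕ.suc m ℤ.⊖ ℕ.suc n ⟧ℤ            ≡⟨ ≡.cong ⟦_⟧ℤ (ℤ.[1+m]⊖[1+n]≡m⊖n m n) ⟩
      ⟦ m ℤ.⊖ n ⟧ℤ                        ≈⟨ ⊖-homo m n ⟩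
      m ×ᴺ 1# - n ×ᴺ 1#                     ≈⟨ +-congʳ (xyx⁻¹≈y 1# (m ×ᴺ 1#)) ⟨
      (1# +ᴷ m ×ᴺ 1# - 1#) - n ×ᴺ 1#         ≈⟨ +ᴷ-assoc _ _ _ ⟩
      (1# +ᴷ m ×ᴺ 1#) +ᴷ (- 1# - n ×ᴺ 1#)     ≈⟨ +-congˡ (-‿+-comm _ _) ⟩
      (1# +ᴷ m ×ᴺ 1#) - (1# +ᴷ n ×ᴺ 1#)       ≈⟨ +-cong (1+× m 1#) (-‿cong (1+× n 1#)) ⟨
      ℕ.suc m ×ᴺ 1# - ℕ.suc n ×ᴺ 1#         ∎

    +-homo : ∀ i j → ⟦ i ℤ.+ j ⟧ℤ ≈ ⟦ i ⟧ℤ +ᴷ ⟦ j ⟧ℤ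
    +-homo (+ m)    (+ n)    = ×-homo-+ 1# m n
    +-homo (+ m)    -[1+ n ] = ⊖-homo m (ℕ.suc n)
    +-homo -[1+ m ] (+ n)    = trans (⊖-homo n (ℕ.suc m)) (+-comm _ _)
    +-homo -[1+ m ] -[1+ n ] = begin
      - (ℕ.suc (ℕ.suc (m ℕ.+ n)) ×ᴺ 1#)           ≡⟨ ≡.cong (λ k → - (k ×ᴺ 1#)) (≡.sym (+-suc (ℕ.suc m) n)) ⟩
      - ((ℕ.suc m ℕ.+ ℕ.suc n) ×ᴺ 1#)             ≈⟨ -‿cong (×-homo-+ 1# (ℕ.suc m) (ℕ.suc n)) ⟩
      - (ℕ.suc m ×ᴺ 1# +ᴷ ℕ.suc n ×ᴺ 1#)            ≈⟨ -‿+-comm _ _ ⟨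
      - (ℕ.suc m ×ᴺ 1#) - (ℕ.suc n ×ᴺ 1#)          ∎

    ◃-homo⁻ : ∀ n → ⟦ Sign.- ℤ.◃ n ⟧ℤ ≈ - (n ×ᴺ 1#)
    ◃-homo⁻ ℕ.zero    = sym -0#≈0#
    ◃-homo⁻ (ℕ.suc n) = refl

    ◃-homo⁺ : ∀ n → ⟦ Sign.+ ℤ.◃ n ⟧ℤ ≈ n ×ᴺ 1#
    ◃-homo⁺ ℕ.zero    = refl
    ◃-homo⁺ (ℕ.suc n) = refl

    *-homo : ∀ i j → ⟦ i ℤ.* j ⟧ℤ ≈ ⟦ i ⟧ℤ * ⟦ j ⟧ℤ
    *-homo (+ m)    (+ n)    = trans (◃-homo⁺ (m ℕ.* n)) (×1-homo-* m n)
    *-homo (+ m)    -[1+ n ] = trans (◃-homo⁻ (m ℕ.* ℕ.suc n))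
      (trans (-‿cong (×1-homo-* m (ℕ.suc n))) (-‿distribʳ-* _ _))
    *-homo -[1+ m ] (+ n)    = trans (◃-homo⁻ (ℕ.suc m ℕ.* n))
      (trans (-‿cong (×1-homo-* (ℕ.suc m) n)) (-‿distribˡ-* _ _))
    *-homo -[1+ m ] -[1+ n ] = trans (◃-homo⁺ (ℕ.suc m ℕ.* ℕ.suc n))
      (trans (×1-homo-* (ℕ.suc m) (ℕ.suc n))
      (trans (sym (-‿involutive _)) (trans (-‿cong (-‿distribˡ-* _ _)) (-‿distribʳ-* _ _))))

    homomorphism : CommutativeRing.rawRing ℤ.+-*-commutativeRing -Raw-AlmostCommutative⟶ fromCommutativeRing R
    homomorphism = record
      { ⟦_⟧ = ⟦_⟧ℤ ; +-homo = +-homo ; *-homo = *-homo ; -‿homo = neg-homo ; 0-homo = refl ; 1-homo = refl }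

    coeff≟ : ∀ i j → Maybe.Maybe (⟦ i ⟧ℤ ≈ ⟦ j ⟧ℤ)
    coeff≟ i j = Maybe.map (λ { ≡.refl → refl }) (dec⇒maybe (i ℤ.≟ j))

  open Algebra.Solver.Ring _ _ homomorphism coeff≟ public
    using (Polynomial; solve; con; _:+_; _:*_; _:-_; :-_; _:=_)

------------------------------------------------------------------------
-- Relations between the phase spaces K²ⁿ

module PhaseSpace {c ℓ} (K : Field c ℓ) where
  open Field K hiding (zero; +-assoc; +-identityʳ; inverse) renaming (_+_ to _+ᴷ_)
  open VecEquality (×-setoid setoid setoid) using (_≋_; ≋-refl; ≋-sym; ≋-trans; ++⁺; []; _∷_) public

  Phase : ℕ → Set c
  Phase n = Vec (Carrier × Carrier) n

  infixl 6 _⊕_ _⊖_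
  infixr 7 _·_

  𝟎 : ∀ {n} → Phase n
  𝟎 = replicate _ (0# , 0#)

  _⊕_ : ∀ {n} → Phase n → Phase n → Phase n
  _⊕_ = zipWith λ (z , x) (z′ , x′) → z +ᴷ z′ , x +ᴷ x′

  _⊖_ : ∀ {n} → Phase n → Phase n → Phase n
  _⊖_ = zipWith λ (z , x) (z′ , x′) → z - z′ , x - x′

  _·_ : ∀ {n} → Carrier → Phase n → Phase n
  k · v = map (λ (z , x) → k * z , k * x) v

  ω : ∀ {n} → Phase n → Phase n → Carrier
  ω []            []              = 0#
  ω ((z , x) ∷ v) ((z′ , x′) ∷ v′) = (z * x′ - x * z′) +ᴷ ω v v′

  record Relation (n m : ℕ) : Set (suc (c ⊔ ℓ)) where
    field
      holds : Phase n → Phase m → Set (c ⊔ ℓ)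
      resp  : ∀ {v v′ w w′} → v ≋ v′ → w ≋ w′ → holds v w → holds v′ w′

  open Relation public

  infix 4 _⊆_ _≐_

  _⊆_ : ∀ {n m} → Relation n m → Relation n m → Set (c ⊔ ℓ)
  R ⊆ S = ∀ v w → holds R v w → holds S v w

  _≐_ : ∀ {n m} → Relation n m → Relation n m → Set (c ⊔ ℓ)
  R ≐ S = R ⊆ S × S ⊆ R

  ≋-reflexive : ∀ {n} {v w : Phase n} → v ≡ w → v ≋ w
  ≋-reflexive ≡.refl = ≋-refl

  take-cong : ∀ n {m} {v w : Phase (n + m)} → v ≋ w → take n v ≋ take n w
  take-cong zero      v≋w       = []
  take-cong (ℕ.suc n) (p ∷ v≋w) = p ∷ take-cong n v≋w

  drop-cong : ∀ n {m} {v w : Phase (n + m)} → v ≋ w → drop n v ≋ drop n w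
  drop-cong zero      v≋w       = v≋w
  drop-cong (ℕ.suc n) (p ∷ v≋w) = drop-cong n v≋w

  take-++ : ∀ {n m} (v : Phase n) (w : Phase m) → take n (v ++ w) ≋ v
  take-++ []      w = []
  take-++ (p ∷ v) w = (refl , refl) ∷ take-++ v w

  drop-++ : ∀ {n m} (v : Phase n) (w : Phase m) → drop n (v ++ w) ≋ w
  drop-++ []      w = ≋-refl
  drop-++ (p ∷ v) w = drop-++ v w

  take-drop-join : ∀ n {m} {v w : Phase (n + m)} →
                   take n v ≋ take n w → drop n v ≋ drop n w → v ≋ w
  take-drop-join zero                          p       q = q
  take-drop-join (ℕ.suc n) {v = _ ∷ _} {_ ∷ _} (e ∷ p) q = e ∷ take-drop-join n p q

  module Assoc n {m k} {v : Phase ((n + m) + k)} {v′ : Phase (n + (m + k))} (e : v ≋ v′) where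
    fst : take n (take (n + m) v) ≋ take n v′
    fst = go n e
      where
      go : ∀ n {m k} {v : Phase ((n + m) + k)} {v′ : Phase (n + (m + k))} → v ≋ v′ →
           take n (take (n + m) v) ≋ take n v′
      go zero      e       = []
      go (ℕ.suc n) (p ∷ e) = p ∷ go n e

    snd : drop n (take (n + m) v) ≋ take m (drop n v′)
    snd = go n e
      where
      go : ∀ n {m k} {v : Phase ((n + m) + k)} {v′ : Phase (n + (m + k))} → v ≋ v′ →
           drop n (take (n + m) v) ≋ take m (drop n v′)
      go zero      {m} e       = take-cong m e
      go (ℕ.suc n)     (p ∷ e) = go n e

    thd : drop (n + m) v ≋ drop m (drop n v′)
    thd = go n e
      where
      go : ∀ n {m k} {v : Phase ((n + m) + k)} {v′ : Phase (n + (m + k))} → v ≋ v′ →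
           drop (n + m) v ≋ drop m (drop n v′)
      go zero      {m} e       = drop-cong m e
      go (ℕ.suc n)     (p ∷ e) = go n e

  take-unit : ∀ n {v : Phase (n + 0)} {v′ : Phase n} → v ≋ v′ → take n v ≋ v′
  take-unit zero      []      = []
  take-unit (ℕ.suc n) (p ∷ e) = p ∷ take-unit n e

  transport : ∀ {n n′} → n ≡ n′ → Phase n → Phase n′
  transport = subst Phase

  transport-≋ : ∀ {n n′} (p : n ≡ n′) (v : Phase n) → transport p v ≋ v
  transport-≋ ≡.refl v = ≋-refl

  cast⁺ : ∀ {n n′ m m′} (p : n ≡ n′) (q : m ≡ m′) (R : Relation n m)
          {v : Phase n} {v′ : Phase n′} {w : Phase m} {w′ : Phase m′} →
          v ≋ v′ → w ≋ w′ → holds R v w → holds (subst₂ Relation p q R) v′ w′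
  cast⁺ ≡.refl ≡.refl R = resp R

  cast⁻ : ∀ {n n′ m m′} (p : n ≡ n′) (q : m ≡ m′) (R : Relation n m)
          {v : Phase n} {v′ : Phase n′} {w : Phase m} {w′ : Phase m′} →
          v ≋ v′ → w ≋ w′ → holds (subst₂ Relation p q R) v′ w′ → holds R v w
  cast⁻ ≡.refl ≡.refl R e e′ = resp R (≋-sym e) (≋-sym e′)

  infixr 9 _∘ᴿ_
  infixr 10 _⊗ᴿ_

  idᴿ : ∀ n → Relation n n
  idᴿ n = record
    { holds = _≋_
    ; resp  = λ e e′ h → ≋-trans (≋-sym e) (≋-trans h e′)
    }

  _∘ᴿ_ : ∀ {n m k} → Relation m k → Relation n m → Relation n k
  S ∘ᴿ R = record
    { holds = λ u w → ∃[ v ] holds R u v × holds S v w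
    ; resp  = λ e e′ (v , r , s) → v , resp R e ≋-refl r , resp S ≋-refl e′ s
    }

  _⊗ᴿ_ : ∀ {n m n′ m′} → Relation n m → Relation n′ m′ → Relation (n + n′) (m + m′)
  _⊗ᴿ_ {n} {m} R S = record
    { holds = λ v w → holds R (take n v) (take m w) × holds S (drop n v) (drop m w)
    ; resp  = λ e e′ (r , s) → resp R (take-cong n e) (take-cong m e′) r
                             , resp S (drop-cong n e) (drop-cong m e′) s
    }

  σᴿ : ∀ n m → Relation (n + m) (m + n)
  σᴿ n m = record
    { holds = λ v w → take m w ≋ drop n v × drop m w ≋ take n v
    ; resp  = λ e e′ (p , q) →
        ≋-trans (take-cong m (≋-sym e′)) (≋-trans p (drop-cong n e)) ,
        ≋-trans (drop-cong m (≋-sym e′)) (≋-trans q (take-cong n e))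
    }

  -- The dagger is the relational converse.  Twisting it by the sign change
  -- (z , x) ↦ (z , - x) would turn it into the transpose determined by η₁
  -- and ε₁.  The shear (z , x) ↦ (z + x , x) would then not be an isometry
  -- if 1 + 1 ≉ 0, and the discard construction would distinguish d from
  -- its composite with the shear, although coisotropic relations do not.
  _†ᴿ : ∀ {n m} → Relation n m → Relation m n
  R †ᴿ = record
    { holds = λ w v → holds R v w
    ; resp  = λ e e′ → resp R e′ e
    }

  η₁ᴿ : Relation 0 2
  η₁ᴿ = record
    { holds = λ _ w → ∃[ z ] ∃[ x ] w ≋ (z , x) ∷ (z , - x) ∷ []
    ; resp  = λ _ e (z , x , h) → z , x , ≋-trans (≋-sym e) h
    }

  ε₁ᴿ : Relation 2 0
  ε₁ᴿ = record
    { holds = λ v _ → ∃[ z ] ∃[ x ] v ≋ (z , x) ∷ (z , - x) ∷ []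
    ; resp  = λ e _ (z , x , h) → z , x , ≋-trans (≋-sym e) h
    }

  open Algebra.Properties.Ring ring using (-‿involutive)

  swapᴾ : ∀ n {m} → Phase (n + m) → Phase (m + n)
  swapᴾ n v = drop n v ++ take n v

  σ-swapᴾ : ∀ n m (v : Phase (n + m)) → holds (σᴿ n m) v (swapᴾ n v)
  σ-swapᴾ n m v = take-++ (drop n v) (take n v) , drop-++ (drop n v) (take n v)

  interchangeᴿ : ∀ {n m k n′ m′ k′} (f : Relation m k) (g : Relation n m)
                 (f′ : Relation m′ k′) (g′ : Relation n′ m′) →
                 (f ∘ᴿ g) ⊗ᴿ (f′ ∘ᴿ g′) ≐ (f ⊗ᴿ f′) ∘ᴿ (g ⊗ᴿ g′)
  interchangeᴿ {m = m} f g f′ g′ =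
    (λ v w ((u , r , s) , (u′ , r′ , s′)) → u ++ u′ ,
      (resp g ≋-refl (≋-sym (take-++ u u′)) r , resp g′ ≋-refl (≋-sym (drop-++ u u′)) r′) ,
      (resp f (≋-sym (take-++ u u′)) ≋-refl s , resp f′ (≋-sym (drop-++ u u′)) ≋-refl s′)) ,
    (λ v w (u , (r , r′) , (s , s′)) → (take m u , r , s) , (drop m u , r′ , s′))

  ⊗-assocᴿ : ∀ {n m n′ m′ n″ m″} (f : Relation n m) (g : Relation n′ m′) (h : Relation n″ m″) →
             subst₂ Relation (+-assoc n n′ n″) (+-assoc m m′ m″) ((f ⊗ᴿ g) ⊗ᴿ h) ≐ f ⊗ᴿ (g ⊗ᴿ h)
  ⊗-assocᴿ {n} {m} {n′} {m′} {n″} {m″} f g h = to , from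
    where
    p = +-assoc n n′ n″
    q = +-assoc m m′ m″
    to : subst₂ Relation p q ((f ⊗ᴿ g) ⊗ᴿ h) ⊆ f ⊗ᴿ (g ⊗ᴿ h)
    to v w r =
      let ev = transport-≋ (≡.sym p) v
          ew = transport-≋ (≡.sym q) w
          ((rf , rg) , rh) = cast⁻ p q ((f ⊗ᴿ g) ⊗ᴿ h) ev ew r
      in resp f (Assoc.fst n ev) (Assoc.fst m ew) rf ,
         resp g (Assoc.snd n ev) (Assoc.snd m ew) rg ,
         resp h (Assoc.thd n ev) (Assoc.thd m ew) rh
    from : f ⊗ᴿ (g ⊗ᴿ h) ⊆ subst₂ Relation p q ((f ⊗ᴿ g) ⊗ᴿ h)
    from v w (rf , rg , rh) =
      let ev = transport-≋ (≡.sym p) v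
          ew = transport-≋ (≡.sym q) w
      in cast⁺ p q ((f ⊗ᴿ g) ⊗ᴿ h) ev ew
           ((resp f (≋-sym (Assoc.fst n ev)) (≋-sym (Assoc.fst m ew)) rf ,
             resp g (≋-sym (Assoc.snd n ev)) (≋-sym (Assoc.snd m ew)) rg) ,
            resp h (≋-sym (Assoc.thd n ev)) (≋-sym (Assoc.thd m ew)) rh)

  ⊗-identityʳᴿ : ∀ {n m} (f : Relation n m) →
                 subst₂ Relation (+-identityʳ n) (+-identityʳ m) (f ⊗ᴿ idᴿ 0) ≐ f
  ⊗-identityʳᴿ {n} {m} f =
    (λ v w r →
      let ev = transport-≋ (≡.sym p) v
          ew = transport-≋ (≡.sym q) w
      in resp f (take-unit n ev) (take-unit m ew) (proj₁ (cast⁻ p q (f ⊗ᴿ idᴿ 0) ev ew r))) ,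
    (λ v w r →
      let ev = transport-≋ (≡.sym p) v
          ew = transport-≋ (≡.sym q) w
      in cast⁺ p q (f ⊗ᴿ idᴿ 0) ev ew
           (resp f (≋-sym (take-unit n ev)) (≋-sym (take-unit m ew)) r , empty≋ _ _))
    where
    p = +-identityʳ n
    q = +-identityʳ m
    empty≋ : (v w : Phase 0) → v ≋ w
    empty≋ [] [] = []

  σ-naturalᴿ : ∀ {n m n′ m′} (f : Relation n m) (g : Relation n′ m′) →
               σᴿ m m′ ∘ᴿ (f ⊗ᴿ g) ≐ (g ⊗ᴿ f) ∘ᴿ σᴿ n n′
  σ-naturalᴿ {n} {m} {n′} {m′} f g =
    (λ v w (u , (rf , rg) , (p , q)) →
      let (p′ , q′) = σ-swapᴾ n n′ v
      in swapᴾ n v , (p′ , q′) ,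
         (resp g (≋-sym p′) (≋-sym p) rg , resp f (≋-sym q′) (≋-sym q) rf)) ,
    (λ v w (u , (p , q) , (rg , rf)) →
      let (p′ , q′) = σ-swapᴾ m′ m w
      in swapᴾ m′ w ,
         (resp f q (≋-sym p′) rf , resp g p (≋-sym q′) rg) ,
         (≋-sym q′ , ≋-sym p′))

  σ-involutiveᴿ : ∀ n m → σᴿ m n ∘ᴿ σᴿ n m ≐ idᴿ (n + m)
  σ-involutiveᴿ n m =
    (λ v w (u , (p , q) , (p′ , q′)) →
      take-drop-join n (≋-sym (≋-trans p′ q)) (≋-sym (≋-trans q′ p))) ,
    (λ v w e →
      let (p , q) = σ-swapᴾ n m v
      in swapᴾ n v , (p , q) ,
         (≋-trans (take-cong n (≋-sym e)) (≋-sym q) , ≋-trans (drop-cong n (≋-sym e)) (≋-sym p)))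

  σ-hexagonᴿ : ∀ n m k →
               σᴿ n (m + k) ≐
               subst₂ Relation (+-assoc n m k) (≡.sym (+-assoc m k n))
                 ((idᴿ m ⊗ᴿ σᴿ n k) ∘ᴿ subst₂ Relation ≡.refl (+-assoc m n k) (σᴿ n m ⊗ᴿ idᴿ k))
  σ-hexagonᴿ n m k = to , from
    where
    p = +-assoc n m k
    q = +-assoc m k n
    r = +-assoc m n k
    inner = σᴿ n m ⊗ᴿ idᴿ k
    outer = (idᴿ m ⊗ᴿ σᴿ n k) ∘ᴿ subst₂ Relation ≡.refl r inner
    to : σᴿ n (m + k) ⊆ subst₂ Relation p (≡.sym q) outer
    to v w (s , t) =
      let ev = transport-≋ (≡.sym p) v
          ew = ≋-sym (transport-≋ q w)
          a  = take n v
          b  = take m (drop n v)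
          c′ = drop m (drop n v)
          u  = b ++ (a ++ c′)
          eu = transport-≋ (≡.sym r) u
          ub = take-++ b (a ++ c′)
          uac = drop-++ b (a ++ c′)
          ua = ≋-trans (take-cong n uac) (take-++ a c′)
          uc = ≋-trans (drop-cong n uac) (drop-++ a c′)
      in cast⁺ p (≡.sym q) outer ev (≋-sym ew)
           (u ,
            cast⁺ ≡.refl r inner ≋-refl eu
              ((≋-trans (Assoc.fst m eu) (≋-trans ub (≋-sym (Assoc.snd n ev))) ,
                ≋-trans (Assoc.snd m eu) (≋-trans ua (≋-sym (Assoc.fst n ev)))) ,
               ≋-trans (Assoc.thd n ev) (≋-trans (≋-sym uc) (≋-sym (Assoc.thd m eu)))) ,
            (≋-trans ub (≋-trans (take-cong m (≋-sym s)) (Assoc.fst m ew)) ,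
             ≋-trans (≋-sym (Assoc.snd m ew)) (≋-trans (drop-cong m s) (≋-sym uc)) ,
             ≋-trans (≋-sym (Assoc.thd m ew)) (≋-trans t (≋-sym ua))))
    from : subst₂ Relation p (≡.sym q) outer ⊆ σᴿ n (m + k)
    from v w h =
      let ev = transport-≋ (≡.sym p) v
          ew = ≋-sym (transport-≋ q w)
          (u , h₁ , (i , s , t)) = cast⁻ p (≡.sym q) outer ev (≋-sym ew) h
          eu = transport-≋ (≡.sym r) u
          ((s′ , t′) , i′) = cast⁻ ≡.refl r inner ≋-refl eu h₁
          ub = ≋-trans (≋-sym (Assoc.fst m eu)) (≋-trans s′ (Assoc.snd n ev))
          ua = ≋-trans (≋-sym (Assoc.snd m eu)) (≋-trans t′ (Assoc.fst n ev))
          uc = ≋-trans (≋-sym (Assoc.thd m eu)) (≋-trans (≋-sym i′) (Assoc.thd n ev))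
      in take-drop-join m
           (≋-trans (Assoc.fst m ew) (≋-trans (≋-sym i) ub))
           (≋-trans (Assoc.snd m ew) (≋-trans s uc)) ,
         ≋-trans (Assoc.thd m ew) (≋-trans t ua)

  snakeˡᴿ : (ε₁ᴿ ⊗ᴿ idᴿ 1) ∘ᴿ (idᴿ 1 ⊗ᴿ η₁ᴿ) ≐ idᴿ 1
  snakeˡᴿ =
    (λ { (p ∷ []) (s ∷ [])
         (q₁ ∷ q₂ ∷ q₃ ∷ [] , ((e₁ , e₂) ∷ [] , z , x , (a₁ , a₂) ∷ (b₁ , b₂) ∷ []) ,
          ((z′ , x′ , (c₁ , c₂) ∷ (d₁ , d₂) ∷ []) , (f₁ , f₂) ∷ [])) →
         (trans e₁ (trans c₁ (trans (sym d₁) (trans a₁ (trans (sym b₁) f₁)))) ,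
          trans e₂ (trans c₂ (trans (sym (-‿involutive x′))
            (trans (-‿cong (trans (sym d₂) a₂)) (trans (sym b₂) f₂))))) ∷ [] }) ,
    (λ { ((z , x) ∷ []) (s ∷ []) ((f₁ , f₂) ∷ []) →
         (z , x) ∷ (z , - x) ∷ (z , - - x) ∷ [] ,
         (≋-refl , z , - x , ≋-refl) ,
         ((z , x , ≋-refl) , (f₁ , trans (-‿involutive x) f₂) ∷ []) })

  snakeʳᴿ : (idᴿ 1 ⊗ᴿ ε₁ᴿ) ∘ᴿ (η₁ᴿ ⊗ᴿ idᴿ 1) ≐ idᴿ 1
  snakeʳᴿ =
    (λ { (p ∷ []) (s ∷ [])
         (q₁ ∷ q₂ ∷ q₃ ∷ [] , ((z , x , (a₁ , a₂) ∷ (b₁ , b₂) ∷ []) , (e₁ , e₂) ∷ []) ,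
          ((f₁ , f₂) ∷ [] , z′ , x′ , (c₁ , c₂) ∷ (d₁ , d₂) ∷ [])) →
         (trans e₁ (trans d₁ (trans (sym c₁) (trans b₁ (trans (sym a₁) f₁)))) ,
          trans e₂ (trans d₂ (trans (-‿cong (trans (sym c₂) b₂))
            (trans (-‿involutive x) (trans (sym a₂) f₂))))) ∷ [] }) ,
    (λ { ((z , x) ∷ []) (s ∷ []) ((f₁ , f₂) ∷ []) →
         (z , x) ∷ (z , - x) ∷ (z , x) ∷ [] ,
         ((z , x , ≋-refl) , ≋-refl) ,
         ((f₁ , f₂) ∷ [] , z , - x , (refl , refl) ∷ (refl , sym (-‿involutive x)) ∷ []) })

  RelPROP : DaggerCompactPROP (suc (c ⊔ ℓ)) (c ⊔ ℓ)
  RelPROP = record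
    { prop = record
      { Hom           = Relation
      ; _≈_           = _≐_
      ; id            = idᴿ
      ; _∘_           = _∘ᴿ_
      ; _⊗_           = _⊗ᴿ_
      ; σ             = σᴿ
      ; isEquivalence = record
        { refl  = (λ _ _ r → r) , (λ _ _ r → r)
        ; sym   = swap
        ; trans = λ (f , f′) (g , g′) → (λ v w → g v w ∘′ f v w) , (λ v w → f′ v w ∘′ g′ v w)
        }
      ; ∘-cong        = λ (f , f′) (g , g′) →
          (λ u w (v , r , s) → v , g u v r , f v w s) ,
          (λ u w (v , r , s) → v , g′ u v r , f′ v w s)
      ; identityˡ     = λ f → (λ u w (v , r , e) → resp f ≋-refl e r) ,
                              (λ u w r → w , r , ≋-refl)
      ; identityʳ     = λ f → (λ u w (v , e , r) → resp f (≋-sym e) ≋-refl r) ,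
                              (λ u w r → u , ≋-refl , r)
      ; assoc         = λ f g h → (λ u w (v , r , v′ , s , t) → v′ , (v , r , s) , t) ,
                                  (λ u w (v′ , (v , r , s) , t) → v , r , v′ , s , t)
      ; ⊗-cong        = λ (f , f′) (g , g′) →
          (λ v w (r , s) → f _ _ r , g _ _ s) , (λ v w (r , s) → f′ _ _ r , g′ _ _ s)
      ; ⊗-id          = λ n m → (λ v w (p , q) → take-drop-join n p q) ,
                                (λ v w e → take-cong n e , drop-cong n e)
      ; interchange   = interchangeᴿ
      ; ⊗-assoc       = ⊗-assocᴿ
      ; ⊗-identityˡ   = λ f → (λ _ _ → proj₂) , (λ _ _ r → [] , r)
      ; ⊗-identityʳ   = ⊗-identityʳᴿ
      ; σ-natural     = σ-naturalᴿ
      ; σ-involutive  = σ-involutiveᴿ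
      ; σ-hexagon     = σ-hexagonᴿ
      }
    ; _†           = _†ᴿ
    ; †-cong       = λ (f , f′) → (λ w v → f v w) , (λ w v → f′ v w)
    ; †-involutive = λ f → (λ _ _ r → r) , (λ _ _ r → r)
    ; †-id         = λ n → (λ _ _ → ≋-sym) , (λ _ _ → ≋-sym)
    ; †-∘          = λ f g → (λ _ _ (v , r , s) → v , s , r) , (λ _ _ (v , s , r) → v , r , s)
    ; †-⊗          = λ f g → (λ _ _ r → r) , (λ _ _ r → r)
    ; †-σ          = λ n m → (λ _ _ (p , q) → ≋-sym q , ≋-sym p) , (λ _ _ (p , q) → ≋-sym q , ≋-sym p)
    ; η₁           = η₁ᴿ
    ; ε₁           = ε₁ᴿ
    ; snakeˡ       = snakeˡᴿ
    ; snakeʳ       = snakeʳᴿ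
    ; ε₁≈η₁†       =
        (λ { (p ∷ q ∷ []) [] (z , x , (a₁ , a₂) ∷ (b₁ , b₂) ∷ []) →
             q ∷ p ∷ [] , (≋-refl , ≋-refl) ,
             z , - x , (b₁ , b₂) ∷ (a₁ , trans a₂ (sym (-‿involutive x))) ∷ [] }) ,
        (λ { (p ∷ q ∷ []) [] (r ∷ s ∷ [] , ((e₁ , e₂) ∷ [] , (f₁ , f₂) ∷ []) ,
                              z , x , (a₁ , a₂) ∷ (b₁ , b₂) ∷ []) →
             z , - x , (trans (sym f₁) b₁ , trans (sym f₂) b₂) ∷
             (trans (sym e₁) a₁ , trans (sym e₂) (trans a₂ (sym (-‿involutive x)))) ∷ [] })
    }

  ----------------------------------------------------------------------
  -- Linear and affine relations

  record IsLinear {n m} (R : Relation n m) : Set (c ⊔ ℓ) where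
    field
      𝟎-closed : holds R 𝟎 𝟎
      ⊕-closed : ∀ {v v′ w w′} → holds R v w → holds R v′ w′ → holds R (v ⊕ v′) (w ⊕ w′)
      ·-closed : ∀ k {v w} → holds R v w → holds R (k · v) (k · w)

  open RingSolver commutativeRing using (solve; con; _:+_; _:*_; _:-_; :-_; _:=_)
  open Algebra.Properties.Ring ring
    using (x∙y⁻¹≈ε⇒x≈y; x≈y⇒x∙y⁻¹≈ε; -‿injective)

  𝟘 𝟙 : ∀ {k} → RingSolver.Polynomial commutativeRing k
  𝟘 = con ℤ.0ℤ
  𝟙 = con ℤ.1ℤ

  ω-cong : ∀ {n} {v v′ w w′ : Phase n} → v ≋ v′ → w ≋ w′ → ω v w ≈ ω v′ w′
  ω-cong []             []             = refl
  ω-cong ((p , q) ∷ e) ((r , s) ∷ e′) =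
    +-cong (+-cong (*-cong p s) (-‿cong (*-cong q r))) (ω-cong e e′)

  ω-congʳ : ∀ {n} (v : Phase n) {w w′ : Phase n} → w ≋ w′ → ω v w ≈ ω v w′
  ω-congʳ v e = ω-cong {v = v} ≋-refl e

  infix 12 _^ω

  _^ω : ∀ {n m} → Relation n m → Relation n m
  R ^ω = record
    { holds = λ v w → ∀ v′ w′ → holds R v′ w′ → ω v v′ - ω w w′ ≈ 0#
    ; resp  = λ e e′ h v′ w′ r →
        trans (+-cong (ω-cong (≋-sym e) ≋-refl) (-‿cong (ω-cong (≋-sym e′) ≋-refl))) (h v′ w′ r)
    }

  IsCoisotropic : ∀ {n m} → Relation n m → Set (c ⊔ ℓ)
  IsCoisotropic R = R ^ω ⊆ R

  IsLagrangian : ∀ {n m} → Relation n m → Set (c ⊔ ℓ)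
  IsLagrangian R = R ≐ R ^ω

  ⊖-cong : ∀ {n} {v v′ w w′ : Phase n} → v ≋ v′ → w ≋ w′ → v ⊖ w ≋ v′ ⊖ w′
  ⊖-cong []            []             = []
  ⊖-cong ((p , q) ∷ e) ((r , s) ∷ e′) = (+-cong p (-‿cong r) , +-cong q (-‿cong s)) ∷ ⊖-cong e e′

  translate : ∀ {n m} → Phase n → Phase m → Relation n m → Relation n m
  translate p q S = record
    { holds = λ v w → holds S (v ⊖ p) (w ⊖ q)
    ; resp  = λ e e′ → resp S (⊖-cong e ≋-refl) (⊖-cong e′ ≋-refl)
    }

  LinearLagrangian : ∀ {n m} → Relation n m → Set (c ⊔ ℓ)
  LinearLagrangian R = IsLinear R × IsLagrangian R

  LinearCoisotropic : ∀ {n m} → Relation n m → Set (c ⊔ ℓ)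
  LinearCoisotropic R = IsLinear R × IsCoisotropic R

  IsEmpty : ∀ {n m} → Relation n m → Set (c ⊔ ℓ)
  IsEmpty R = ∀ v w → ¬ holds R v w

  -- Either empty, or a translate of a linear subspace in the given class.
  Affine : (∀ {n m} → Relation n m → Set (c ⊔ ℓ)) →
           ∀ {n m} → Relation n m → Set (suc (c ⊔ ℓ))
  Affine Q {n} {m} R =
    IsEmpty R ⊎
    (Σ[ p ∈ Phase n ] Σ[ q ∈ Phase m ] Σ[ S ∈ Relation n m ] Q S × R ≐ translate p q S)

  AffineLagrangian : ∀ {n m} → Relation n m → Set (suc (c ⊔ ℓ))
  AffineLagrangian = Affine LinearLagrangian

  AffineCoisotropic : ∀ {n m} → Relation n m → Set (suc (c ⊔ ℓ))
  AffineCoisotropic = Affine LinearCoisotropic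

  Lagrangian⇒Coisotropic : ∀ {n m} {R : Relation n m} → LinearLagrangian R → LinearCoisotropic R
  Lagrangian⇒Coisotropic (lin , _ , cois) = lin , cois

  Affine-map : ∀ {Q Q′ : ∀ {n m} → Relation n m → Set (c ⊔ ℓ)} →
               (∀ {n m} {R : Relation n m} → Q R → Q′ R) →
               ∀ {n m} {R : Relation n m} → Affine Q R → Affine Q′ R
  Affine-map f (inj₁ e)                 = inj₁ e
  Affine-map f (inj₂ (p , q , S , s , e)) = inj₂ (p , q , S , f s , e)

  discardᴿ : Relation 1 0
  discardᴿ = record { holds = λ _ _ → ⊤ ; resp = λ _ _ _ → tt }

  discard-coisotropic : LinearCoisotropic discardᴿ
  discard-coisotropic = record { 𝟎-closed = tt ; ⊕-closed = λ _ _ → tt ; ·-closed = λ _ _ → tt }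
                      , λ _ _ _ → tt

  ⊖-𝟎 : ∀ {n} (v : Phase n) → v ⊖ 𝟎 ≋ v
  ⊖-𝟎 []            = []
  ⊖-𝟎 ((z , x) ∷ v) = (e z , e x) ∷ ⊖-𝟎 v
    where
    e : ∀ a → a - 0# ≈ a
    e = solve 1 (λ a → a :- 𝟘 := a) refl

  Linear⇒Affine : ∀ {Q : ∀ {n m} → Relation n m → Set (c ⊔ ℓ)} {n m} {R : Relation n m} →
                  Q R → Affine Q R
  Linear⇒Affine {R = R} r = inj₂ (𝟎 , 𝟎 , R , r ,
    (λ v w → resp R (≋-sym (⊖-𝟎 v)) (≋-sym (⊖-𝟎 w))) ,
    (λ v w → resp R (⊖-𝟎 v) (⊖-𝟎 w)))

  ----------------------------------------------------------------------
  -- Closure of the classes of relations under the operations of a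
  -- †-compact prop

  ⊕-cong : ∀ {n} {v v′ w w′ : Phase n} → v ≋ v′ → w ≋ w′ → v ⊕ w ≋ v′ ⊕ w′
  ⊕-cong []            []             = []
  ⊕-cong ((p , q) ∷ e) ((r , s) ∷ e′) = (+-cong p r , +-cong q s) ∷ ⊕-cong e e′

  ·-cong : ∀ {n} k {v v′ : Phase n} → v ≋ v′ → k · v ≋ k · v′
  ·-cong k []            = []
  ·-cong k ((p , q) ∷ e) = (*-congˡ p , *-congˡ q) ∷ ·-cong k e

  ⊖-rebase : ∀ {n} (v a p : Phase n) → (v ⊖ p) ⊕ (- 1# · (a ⊖ p)) ≋ v ⊖ a
  ⊖-rebase []            []              []              = []
  ⊖-rebase ((z , x) ∷ v) ((z′ , x′) ∷ a) ((z″ , x″) ∷ p) = (e z z′ z″ , e x x′ x″) ∷ ⊖-rebase v a p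
    where
    e : ∀ a b c → (a - c) +ᴷ - 1# * (b - c) ≈ a - b
    e = solve 3 (λ a b c → (a :- c) :+ :- 𝟙 :* (b :- c) := a :- b) refl

  ⊖-chain : ∀ {n} (v a p : Phase n) → (v ⊖ a) ⊕ (a ⊖ p) ≋ v ⊖ p
  ⊖-chain []            []              []              = []
  ⊖-chain ((z , x) ∷ v) ((z′ , x′) ∷ a) ((z″ , x″) ∷ p) = (e z z′ z″ , e x x′ x″) ∷ ⊖-chain v a p
    where
    e : ∀ a b c → (a - b) +ᴷ (b - c) ≈ a - c
    e = solve 3 (λ a b c → (a :- b) :+ (b :- c) := a :- c) refl

  ⊕-⊖ : ∀ {n} (v w : Phase n) → (v ⊕ w) ⊖ w ≋ v
  ⊕-⊖ []            []              = []
  ⊕-⊖ ((z , x) ∷ v) ((z′ , x′) ∷ w) = (e z z′ , e x x′) ∷ ⊕-⊖ v w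
    where
    e : ∀ a b → (a +ᴷ b) - b ≈ a
    e = solve 2 (λ a b → (a :+ b) :- b := a) refl

  ⊖-linear : ∀ {n} k (a b a′ b′ : Phase n) →
             (a ⊕ k · a′) ⊖ (b ⊕ k · b′) ≋ (a ⊖ b) ⊕ k · (a′ ⊖ b′)
  ⊖-linear k []            []            []            []            = []
  ⊖-linear k ((_ , _) ∷ a) ((_ , _) ∷ b) ((_ , _) ∷ a′) ((_ , _) ∷ b′) =
    (e _ _ _ _ k , e _ _ _ _ k) ∷ ⊖-linear k a b a′ b′
    where
    e : ∀ a b a′ b′ k → (a +ᴷ k * a′) - (b +ᴷ k * b′) ≈ (a - b) +ᴷ k * (a′ - b′)
    e = solve 5 (λ a b a′ b′ k → (a :+ k :* a′) :- (b :+ k :* b′) := (a :- b) :+ k :* (a′ :- b′)) refl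

  ⊖≋𝟎⇒≋ : ∀ {n} (v w : Phase n) → v ⊖ w ≋ 𝟎 {n} → v ≋ w
  ⊖≋𝟎⇒≋ []      []      []            = []
  ⊖≋𝟎⇒≋ (_ ∷ v) (_ ∷ w) ((p , q) ∷ e) = (x∙y⁻¹≈ε⇒x≈y _ _ p , x∙y⁻¹≈ε⇒x≈y _ _ q) ∷ ⊖≋𝟎⇒≋ v w e

  ω-linear : ∀ {n} k (v a b : Phase n) → ω v (a ⊕ k · b) ≈ ω v a +ᴷ k * ω v b
  ω-linear k []            []              []              = solve 1 (λ k → 𝟘 := 𝟘 :+ k :* 𝟘) refl k
  ω-linear k ((z , x) ∷ v) ((z′ , x′) ∷ a) ((z″ , x″) ∷ b) =
    trans (+-congˡ (ω-linear k v a b)) (e z x z′ x′ z″ x″ k (ω v a) (ω v b))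
    where
    e : ∀ z x z′ x′ z″ x″ k s t →
        (z * (x′ +ᴷ k * x″) - x * (z′ +ᴷ k * z″)) +ᴷ (s +ᴷ k * t) ≈
        ((z * x′ - x * z′) +ᴷ s) +ᴷ k * ((z * x″ - x * z″) +ᴷ t)
    e = solve 9 (λ z x z′ x′ z″ x″ k s t →
        (z :* (x′ :+ k :* x″) :- x :* (z′ :+ k :* z″)) :+ (s :+ k :* t) :=
        ((z :* x′ :- x :* z′) :+ s) :+ k :* ((z :* x″ :- x :* z″) :+ t)) refl

  ω-⊖ : ∀ {n} (v a b : Phase n) → ω v (a ⊖ b) ≈ ω v a - ω v b
  ω-⊖ []            []              []              = solve 0 (𝟘 := 𝟘 :- 𝟘) refl
  ω-⊖ ((z , x) ∷ v) ((z′ , x′) ∷ a) ((z″ , x″) ∷ b) =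
    trans (+-congˡ (ω-⊖ v a b)) (e z x z′ x′ z″ x″ (ω v a) (ω v b))
    where
    e : ∀ z x z′ x′ z″ x″ s t →
        (z * (x′ - x″) - x * (z′ - z″)) +ᴷ (s - t) ≈
        ((z * x′ - x * z′) +ᴷ s) - ((z * x″ - x * z″) +ᴷ t)
    e = solve 8 (λ z x z′ x′ z″ x″ s t →
        (z :* (x′ :- x″) :- x :* (z′ :- z″)) :+ (s :- t) :=
        ((z :* x′ :- x :* z′) :+ s) :- ((z :* x″ :- x :* z″) :+ t)) refl

  ω-𝟎ʳ : ∀ {n} (v : Phase n) → ω v 𝟎 ≈ 0#
  ω-𝟎ʳ []            = refl
  ω-𝟎ʳ ((z , x) ∷ v) = trans (+-congˡ (ω-𝟎ʳ v)) (e z x)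
    where
    e : ∀ z x → (z * 0# - x * 0#) +ᴷ 0# ≈ 0#
    e = solve 2 (λ z x → (z :* 𝟘 :- x :* 𝟘) :+ 𝟘 := 𝟘) refl

  ω-split : ∀ n {m} (v w : Phase (n + m)) →
            ω v w ≈ ω (take n v) (take n w) +ᴷ ω (drop n v) (drop n w)
  ω-split zero      v       w       = sym (+-identityˡ _)
  ω-split (ℕ.suc n) (p ∷ v) (q ∷ w) =
    trans (+-congˡ (ω-split n v w)) (sym (Field.+-assoc K _ _ _))

  ω-++ : ∀ {n m} (v : Phase (n + m)) (a : Phase n) (b : Phase m) →
         ω v (a ++ b) ≈ ω (take n v) a +ᴷ ω (drop n v) b
  ω-++ {n} v a b = trans (ω-split n v (a ++ b))
    (+-cong (ω-congʳ (take n v) (take-++ a b)) (ω-congʳ (drop n v) (drop-++ a b)))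

  ω-++-𝟎 : ∀ {n m} (v : Phase (n + m)) (a : Phase n) → ω v (a ++ 𝟎) ≈ ω (take n v) a
  ω-++-𝟎 {n} v a = trans (ω-++ v a 𝟎) (trans (+-congˡ (ω-𝟎ʳ (drop n v))) (Field.+-identityʳ K _))

  ω-𝟎-++ : ∀ n {m} (v : Phase (n + m)) (b : Phase m) → ω v (𝟎 ++ b) ≈ ω (drop n v) b
  ω-𝟎-++ n v b = trans (ω-++ {n} v 𝟎 b) (trans (+-congʳ (ω-𝟎ʳ (take n v))) (+-identityˡ _))

  ω-nondegenerate : ∀ {n} (v w : Phase n) → (∀ u → ω v u ≈ ω w u) → v ≋ w
  ω-nondegenerate []            []              h = []
  ω-nondegenerate ((z , x) ∷ v) ((z′ , x′) ∷ w) h =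
    (trans (sym (ez z x _ (ω-𝟎ʳ v))) (trans (h ((0# , 1#) ∷ 𝟎)) (ez z′ x′ _ (ω-𝟎ʳ w))) ,
     -‿injective (trans (sym (ex z x _ (ω-𝟎ʳ v))) (trans (h ((1# , 0#) ∷ 𝟎)) (ex z′ x′ _ (ω-𝟎ʳ w))))) ∷
    ω-nondegenerate v w (λ u → trans (sym (et z x _)) (trans (h ((0# , 0#) ∷ u)) (et z′ x′ _)))
    where
    ez : ∀ z x s → s ≈ 0# → (z * 1# - x * 0#) +ᴷ s ≈ z
    ez z x s s≈0 = trans (+-congˡ s≈0)
      (solve 2 (λ z x → (z :* 𝟙 :- x :* 𝟘) :+ 𝟘 := z) refl z x)
    ex : ∀ z x s → s ≈ 0# → (z * 0# - x * 1#) +ᴷ s ≈ - x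
    ex z x s s≈0 = trans (+-congˡ s≈0)
      (solve 2 (λ z x → (z :* 𝟘 :- x :* 𝟙) :+ 𝟘 := :- x) refl z x)
    et : ∀ z x s → (z * 0# - x * 0#) +ᴷ s ≈ s
    et = solve 3 (λ z x s → (z :* 𝟘 :- x :* 𝟘) :+ s := s) refl

  perp⁺ : ∀ {n m} (R : Relation n m) v w →
          (∀ v′ w′ → holds R v′ w′ → ω v v′ ≈ ω w w′) → holds (R ^ω) v w
  perp⁺ R v w h v′ w′ r = x≈y⇒x∙y⁻¹≈ε (h v′ w′ r)

  perp⁻ : ∀ {n m} (R : Relation n m) v w →
          holds (R ^ω) v w → ∀ v′ w′ → holds R v′ w′ → ω v v′ ≈ ω w w′
  perp⁻ R v w h v′ w′ r = x∙y⁻¹≈ε⇒x≈y _ _ (h v′ w′ r)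

  IsIsotropic : ∀ {n m} → Relation n m → Set (c ⊔ ℓ)
  IsIsotropic R = R ⊆ R ^ω

  id-linear : ∀ n → IsLinear (idᴿ n)
  id-linear n = record { 𝟎-closed = ≋-refl ; ⊕-closed = ⊕-cong ; ·-closed = ·-cong }

  id-isotropic : ∀ n → IsIsotropic (idᴿ n)
  id-isotropic n v w e = perp⁺ (idᴿ n) v w λ v′ w′ e′ → ω-cong e e′

  id-coisotropic : ∀ n → IsCoisotropic (idᴿ n)
  id-coisotropic n v w h = ω-nondegenerate v w λ u → perp⁻ (idᴿ n) v w h u u ≋-refl

  ∘-linear : ∀ {n m k} {S : Relation m k} {R : Relation n m} →
             IsLinear S → IsLinear R → IsLinear (S ∘ᴿ R)
  ∘-linear s r = record
    { 𝟎-closed = 𝟎 , R.𝟎-closed , S.𝟎-closed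
    ; ⊕-closed = λ (v , a , b) (v′ , a′ , b′) → v ⊕ v′ , R.⊕-closed a a′ , S.⊕-closed b b′
    ; ·-closed = λ k (v , a , b) → k · v , R.·-closed k a , S.·-closed k b
    }
    where
    module S = IsLinear s
    module R = IsLinear r

  ∘-isotropic : ∀ {n m k} {S : Relation m k} {R : Relation n m} →
                IsIsotropic S → IsIsotropic R → IsIsotropic (S ∘ᴿ R)
  ∘-isotropic {S = S} {R} s r u w (v , a , b) = perp⁺ (S ∘ᴿ R) u w λ u′ w′ (v′ , a′ , b′) →
    trans (perp⁻ R u v (r u v a) u′ v′ a′) (perp⁻ S v w (s v w b) v′ w′ b′)

  ⊗-linear : ∀ {n m n′ m′} {R : Relation n m} {S : Relation n′ m′} →
             IsLinear R → IsLinear S → IsLinear (R ⊗ᴿ S)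
  ⊗-linear {n} {m} {n′} {m′} {R} {S} r s = record
    { 𝟎-closed = resp R (≋-sym (take-𝟎 n)) (≋-sym (take-𝟎 m)) R.𝟎-closed
               , resp S (≋-sym (drop-𝟎 n)) (≋-sym (drop-𝟎 m)) S.𝟎-closed
    ; ⊕-closed = λ {v} {v′} {w} {w′} (a , b) (a′ , b′) →
        resp R (≋-reflexive (≡.sym (take-zipWith _ v v′))) (≋-reflexive (≡.sym (take-zipWith _ w w′)))
          (R.⊕-closed a a′) ,
        resp S (≋-reflexive (≡.sym (drop-zipWith {m = n} _ v v′))) (≋-reflexive (≡.sym (drop-zipWith {m = m} _ w w′)))
          (S.⊕-closed b b′)
    ; ·-closed = λ k {v} {w} (a , b) →
        resp R (≋-reflexive (≡.sym (take-map _ n v))) (≋-reflexive (≡.sym (take-map _ m w)))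
          (R.·-closed k a) ,
        resp S (≋-reflexive (≡.sym (drop-map _ n v))) (≋-reflexive (≡.sym (drop-map _ m w)))
          (S.·-closed k b)
    }
    where
    module R = IsLinear r
    module S = IsLinear s
    take-𝟎 : ∀ n {m} → take n (𝟎 {n + m}) ≋ 𝟎 {n}
    take-𝟎 zero      = []
    take-𝟎 (ℕ.suc n) = (refl , refl) ∷ take-𝟎 n
    drop-𝟎 : ∀ n {m} → drop n (𝟎 {n + m}) ≋ 𝟎 {m}
    drop-𝟎 zero      = ≋-refl
    drop-𝟎 (ℕ.suc n) = drop-𝟎 n

  ⊗-isotropic : ∀ {n m n′ m′} {R : Relation n m} {S : Relation n′ m′} →
                IsIsotropic R → IsIsotropic S → IsIsotropic (R ⊗ᴿ S)
  ⊗-isotropic {n} {m} {R = R} {S} r s v w (a , b) = perp⁺ (R ⊗ᴿ S) v w λ v′ w′ (a′ , b′) →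
    trans (ω-split n v v′)
    (trans (+-cong (perp⁻ R (take n v) (take m w) (r _ _ a) _ _ a′) (perp⁻ S (drop n v) (drop m w) (s _ _ b) _ _ b′))
    (sym (ω-split m w w′)))

  ⊗-coisotropic : ∀ {n m n′ m′} {R : Relation n m} {S : Relation n′ m′} →
                  IsLinear R → IsLinear S →
                  IsCoisotropic R → IsCoisotropic S → IsCoisotropic (R ⊗ᴿ S)
  ⊗-coisotropic {n} {m} {R = R} {S} lr ls r s v w h =
    r _ _ (perp⁺ R (take n v) (take m w) λ v′ w′ a →
      trans (sym (ω-++-𝟎 v v′))
      (trans (perp⁻ (R ⊗ᴿ S) v w h (v′ ++ 𝟎) (w′ ++ 𝟎)
        (resp R (≋-sym (take-++ v′ 𝟎)) (≋-sym (take-++ w′ 𝟎)) a ,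
         resp S (≋-sym (drop-++ v′ 𝟎)) (≋-sym (drop-++ w′ 𝟎)) (IsLinear.𝟎-closed ls)))
      (ω-++-𝟎 w w′))) ,
    s _ _ (perp⁺ S (drop n v) (drop m w) λ v′ w′ b →
      trans (sym (ω-𝟎-++ n v v′))
      (trans (perp⁻ (R ⊗ᴿ S) v w h (𝟎 ++ v′) (𝟎 ++ w′)
        (resp R (≋-sym (take-++ 𝟎 v′)) (≋-sym (take-++ 𝟎 w′)) (IsLinear.𝟎-closed lr) ,
         resp S (≋-sym (drop-++ (𝟎 {n}) v′)) (≋-sym (drop-++ (𝟎 {m}) w′)) b))
      (ω-𝟎-++ m w w′)))

  σ-linear : ∀ n m → IsLinear (σᴿ n m)
  σ-linear n m = record
    { 𝟎-closed = ≋-reflexive (take-drop-replicate n m) , ≋-reflexive (drop-take-replicate n m)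
    ; ⊕-closed = λ {v} {v′} {w} {w′} (p , q) (p′ , q′) →
        ≋-trans (≋-reflexive (take-zipWith _ w w′))
        (≋-trans (⊕-cong p p′) (≋-reflexive (≡.sym (drop-zipWith {m = n} _ v v′)))) ,
        ≋-trans (≋-reflexive (drop-zipWith {m = m} _ w w′))
        (≋-trans (⊕-cong q q′) (≋-reflexive (≡.sym (take-zipWith _ v v′))))
    ; ·-closed = λ k {v} {w} (p , q) →
        ≋-trans (≋-reflexive (take-map _ m w))
        (≋-trans (·-cong k p) (≋-reflexive (≡.sym (drop-map _ n v)))) ,
        ≋-trans (≋-reflexive (drop-map _ m w))
        (≋-trans (·-cong k q) (≋-reflexive (≡.sym (take-map _ n v))))
    }
    where
    takeR : ∀ n {m} → take n (𝟎 {n + m}) ≡ 𝟎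
    takeR zero      = ≡.refl
    takeR (ℕ.suc n) = ≡.cong (_ ∷_) (takeR n)
    dropR : ∀ n {m} → drop n (𝟎 {n + m}) ≡ 𝟎
    dropR zero      = ≡.refl
    dropR (ℕ.suc n) = dropR n
    take-drop-replicate : ∀ n m → take m (𝟎 {m + n}) ≡ drop n (𝟎 {n + m})
    take-drop-replicate n m = ≡.trans (takeR m) (≡.sym (dropR n))
    drop-take-replicate : ∀ n m → drop m (𝟎 {m + n}) ≡ take n (𝟎 {n + m})
    drop-take-replicate n m = ≡.trans (dropR m) (≡.sym (takeR n))

  σ-isotropic : ∀ n m → IsIsotropic (σᴿ n m)
  σ-isotropic n m v w (p , q) = perp⁺ (σᴿ n m) v w λ v′ w′ (p′ , q′) →
    trans (ω-split n v v′)
    (trans (+-comm _ _)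
    (trans (+-cong (ω-cong (≋-sym p) (≋-sym p′)) (ω-cong (≋-sym q) (≋-sym q′)))
    (sym (ω-split m w w′))))

  σ-coisotropic : ∀ n m → IsCoisotropic (σᴿ n m)
  σ-coisotropic n m v w h =
    ω-nondegenerate _ _ (λ u →
      trans (sym (ω-++-𝟎 w u))
      (trans (sym (perp⁻ (σᴿ n m) v w h (𝟎 ++ u) (u ++ 𝟎)
        (≋-trans (take-++ u 𝟎) (≋-sym (drop-++ (𝟎 {n}) u)) ,
         ≋-trans (drop-++ u 𝟎) (≋-sym (take-++ 𝟎 u)))))
      (ω-𝟎-++ n v u))) ,
    ω-nondegenerate _ _ (λ u →
      trans (sym (ω-𝟎-++ m w u))
      (trans (sym (perp⁻ (σᴿ n m) v w h (u ++ 𝟎) (𝟎 ++ u)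
        (≋-trans (take-++ 𝟎 u) (≋-sym (drop-++ u 𝟎)) ,
         ≋-trans (drop-++ (𝟎 {m}) u) (≋-sym (take-++ u 𝟎)))))
      (ω-++-𝟎 v u)))

  †-linear : ∀ {n m} {R : Relation n m} → IsLinear R → IsLinear (R †ᴿ)
  †-linear r = record { 𝟎-closed = 𝟎-closed ; ⊕-closed = ⊕-closed ; ·-closed = λ k → ·-closed k }
    where open IsLinear r

  †-isotropic : ∀ {n m} {R : Relation n m} → IsIsotropic R → IsIsotropic (R †ᴿ)
  †-isotropic {R = R} r w v a = perp⁺ (R †ᴿ) w v λ w′ v′ a′ → sym (perp⁻ R v w (r v w a) v′ w′ a′)

  †-coisotropic : ∀ {n m} {R : Relation n m} → IsCoisotropic R → IsCoisotropic (R †ᴿ)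
  †-coisotropic {R = R} r w v h = r v w (perp⁺ R v w λ v′ w′ a → sym (perp⁻ (R †ᴿ) w v h w′ v′ a))

  η-linear : IsLinear η₁ᴿ
  η-linear = record
    { 𝟎-closed = 0# , 0# , (refl , refl) ∷ (refl , solve 0 (𝟘 := :- 𝟘) refl) ∷ []
    ; ⊕-closed = λ { {w = _ ∷ _ ∷ []} {_ ∷ _ ∷ []}
        (z , x , (a₁ , a₂) ∷ (b₁ , b₂) ∷ []) (z′ , x′ , (a₁′ , a₂′) ∷ (b₁′ , b₂′) ∷ []) →
        z +ᴷ z′ , x +ᴷ x′ ,
        (+-cong a₁ a₁′ , +-cong a₂ a₂′) ∷
        (+-cong b₁ b₁′ , trans (+-cong b₂ b₂′)
          (solve 2 (λ x y → :- x :+ :- y := :- (x :+ y)) refl x x′)) ∷ [] }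
    ; ·-closed = λ { k {w = _ ∷ _ ∷ []} (z , x , (a₁ , a₂) ∷ (b₁ , b₂) ∷ []) →
        k * z , k * x , (*-congˡ a₁ , *-congˡ a₂) ∷
        (*-congˡ b₁ , trans (*-congˡ b₂)
          (solve 2 (λ k x → k :* :- x := :- (k :* x)) refl k x)) ∷ [] }
    }

  η-isotropic : IsIsotropic η₁ᴿ
  η-isotropic [] w (z , x , e) = perp⁺ η₁ᴿ [] w λ { [] w′ (z′ , x′ , e′) →
    sym (trans (ω-cong e e′) (f z x z′ x′)) }
    where
    f : ∀ z x z′ x′ → (z * x′ - x * z′) +ᴷ ((z * - x′ - - x * z′) +ᴷ 0#) ≈ 0#
    f = solve 4 (λ z x z′ x′ →
      (z :* x′ :- x :* z′) :+ ((z :* :- x′ :- :- x :* z′) :+ 𝟘) := 𝟘) refl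

  η-coisotropic : IsCoisotropic η₁ᴿ
  η-coisotropic [] ((p , q) ∷ (r , s) ∷ []) h =
    p , q , (refl , refl) ∷ (r≈p , s≈-q) ∷ []
    where
    test : ∀ z x → 0# ≈ (p * x - q * z) +ᴷ ((r * - x - s * z) +ᴷ 0#)
    test z x = perp⁻ η₁ᴿ [] ((p , q) ∷ (r , s) ∷ []) h [] ((z , x) ∷ (z , - x) ∷ []) (z , x , ≋-refl)
    r≈p : r ≈ p
    r≈p = sym (x∙y⁻¹≈ε⇒x≈y p r (sym (trans (test 0# 1#)
      (solve 4 (λ p q r s →
        (p :* 𝟙 :- q :* 𝟘) :+ ((r :* :- 𝟙 :- s :* 𝟘) :+ 𝟘) := p :- r) refl p q r s))))
    s≈-q : s ≈ - q
    s≈-q = sym (x∙y⁻¹≈ε⇒x≈y (- q) s (sym (trans (test 1# 0#)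
      (solve 4 (λ p q r s →
        (p :* 𝟘 :- q :* 𝟙) :+ ((r :* :- 𝟘 :- s :* 𝟙) :+ 𝟘) := :- q :- s) refl p q r s))))

  module _ (em : ExcludedMiddle (c ⊔ ℓ)) where
    em-≈ : ∀ x y → Dec (x ≈ y)
    em-≈ x y with em {Lift c (x ≈ y)}
    ... | yes (lift p) = yes p
    ... | no ¬p        = no λ p → ¬p (lift p)

    -- Linear functionals on a subspace T of X.  On the common kernel of
    -- the components of δ the functional ψ vanishes only if it is a
    -- combination of these components.
    module Duality {X : Set c} (comb : Carrier → X → X → X) where
      IsFunctional : (X → Carrier) → Set (c ⊔ ℓ)
      IsFunctional φ = ∀ k x y → φ (comb k x y) ≈ φ x +ᴷ k * φ y

      Closed : (X → Set (c ⊔ ℓ)) → Set (c ⊔ ℓ)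
      Closed T = ∀ k {x y} → T x → T y → T (comb k x y)

      one : (T : X → Set (c ⊔ ℓ)) → Closed T → (φ ψ : X → Carrier) →
            IsFunctional φ → IsFunctional ψ →
            (∀ x → T x → φ x ≈ 0# → ψ x ≈ 0#) →
            ∃[ a ] (∀ x → T x → ψ x ≈ a * φ x)
      one T closed φ ψ φ-lin ψ-lin h with em {∃[ x ] T x × ¬ (φ x ≈ 0#)}
      ... | no none = 0# , λ x t → trans (h x t (φ≈0 x t)) (sym (zeroˡ _))
        where
        φ≈0 : ∀ x → T x → φ x ≈ 0#
        φ≈0 x t with em-≈ (φ x) 0#
        ... | yes p = p
        ... | no ¬p = contradiction (x , t , ¬p) none
      ... | yes (x₀ , t₀ , φx₀≉0) with Field.inverse K (φ x₀) φx₀≉0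
      ... | i , φx₀i≈1 = i * ψ x₀ , λ x t →
        let k = - (φ x * i)
            φ≈0 = trans (φ-lin k x x₀)
              (trans (solve 3 (λ a i b → a :+ :- (a :* i) :* b := a :- a :* (b :* i)) refl (φ x) i (φ x₀))
              (trans (+-congˡ (-‿cong (*-congˡ φx₀i≈1)))
              (solve 1 (λ a → a :- a :* 𝟙 := 𝟘) refl (φ x))))
            ψ≈0 = trans (sym (ψ-lin k x x₀)) (h _ (closed k t t₀) φ≈0)
        in trans (solve 4 (λ a i b c → c := (c :+ :- (a :* i) :* b) :+ (i :* b) :* a) refl (φ x) i (ψ x₀) (ψ x))
           (trans (+-congʳ ψ≈0) (+-identityˡ _))

      all : ∀ m (T : X → Set (c ⊔ ℓ)) → Closed T → (δ : X → Phase m) (ψ : X → Carrier) →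
            (∀ k x y → δ (comb k x y) ≋ δ x ⊕ k · δ y) → IsFunctional ψ →
            (∀ x → T x → δ x ≋ 𝟎 {m} → ψ x ≈ 0#) →
            ∃[ a ] (∀ x → T x → ψ x ≈ ω a (δ x))
      all zero T closed δ ψ δ-lin ψ-lin h = [] , λ x t → trans (h x t (empty (δ x))) (empty-ω (δ x))
        where
        empty : (v : Phase 0) → v ≋ 𝟎 {0}
        empty [] = []
        empty-ω : (v : Phase 0) → 0# ≈ ω [] v
        empty-ω [] = refl
      all (ℕ.suc m) T closed δ ψ δ-lin ψ-lin h = (β , - α) ∷ proj₁ rec , λ x t →
        trans (split (ψ x) (ω (proj₁ rec) (δ′ x)) (β * δx x))
        (trans (+-congʳ (proj₂ second x t))
        (trans (solve 5 (λ α β z x s → α :* z :+ (β :* x :+ s) := (β :* x :- :- α :* z) :+ s) refl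
                 α β (δz x) (δx x) (ω (proj₁ rec) (δ′ x)))
        (sym (ω-∷ (proj₁ rec) (δ x)))))
        where
        headᴾ : Phase (ℕ.suc m) → Carrier × Carrier
        headᴾ (p ∷ _) = p
        tailᴾ : Phase (ℕ.suc m) → Phase m
        tailᴾ (_ ∷ v) = v
        δz δx : X → Carrier
        δz x = proj₁ (headᴾ (δ x))
        δx x = proj₂ (headᴾ (δ x))
        δ′ : X → Phase m
        δ′ x = tailᴾ (δ x)
        ω-∷ : ∀ {p} a v → ω (p ∷ a) v ≈
              (proj₁ p * proj₂ (headᴾ v) - proj₂ p * proj₁ (headᴾ v)) +ᴷ ω a (tailᴾ v)
        ω-∷ a (q ∷ v) = refl
        head-lin : ∀ k u v w → u ≋ v ⊕ k · w →
                   (proj₁ (headᴾ u) ≈ proj₁ (headᴾ v) +ᴷ k * proj₁ (headᴾ w)) ×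
                   (proj₂ (headᴾ u) ≈ proj₂ (headᴾ v) +ᴷ k * proj₂ (headᴾ w)) ×
                   (tailᴾ u ≋ tailᴾ v ⊕ k · tailᴾ w)
        head-lin k (_ ∷ _) (_ ∷ _) (_ ∷ _) ((p , q) ∷ e) = p , q , e
        join : ∀ u → proj₁ (headᴾ u) ≈ 0# → proj₂ (headᴾ u) ≈ 0# → tailᴾ u ≋ 𝟎 {m} → u ≋ 𝟎 {ℕ.suc m}
        join (_ ∷ _) p q e = (p , q) ∷ e
        δz-lin : IsFunctional δz
        δz-lin k x y = proj₁ (head-lin k _ _ _ (δ-lin k x y))
        δx-lin : IsFunctional δx
        δx-lin k x y = proj₁ (proj₂ (head-lin k _ _ _ (δ-lin k x y)))
        δ′-lin : ∀ k x y → δ′ (comb k x y) ≋ δ′ x ⊕ k · δ′ y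
        δ′-lin k x y = proj₂ (proj₂ (head-lin k _ _ _ (δ-lin k x y)))
        kernel-closed : ∀ {S : X → Set (c ⊔ ℓ)} {φ} → IsFunctional φ → Closed S →
                        Closed (λ x → S x × φ x ≈ 0#)
        kernel-closed φ-lin cl k (s , p) (s′ , q) = cl k s s′ ,
          trans (φ-lin k _ _) (trans (+-cong p (*-congˡ q)) (solve 1 (λ k → 𝟘 :+ k :* 𝟘 := 𝟘) refl k))
        minus-lin : ∀ {φ χ} → IsFunctional φ → IsFunctional χ → IsFunctional (λ x → φ x - χ x)
        minus-lin f g k x y = trans (+-cong (f k x y) (-‿cong (g k x y)))
          (solve 5 (λ a b c d k → (a :+ k :* b) :- (c :+ k :* d) := (a :- c) :+ k :* (b :- d)) refl _ _ _ _ k)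
        scale-lin : ∀ {φ} a → IsFunctional φ → IsFunctional (λ x → a * φ x)
        scale-lin a f k x y = trans (*-congˡ (f k x y))
          (solve 4 (λ a k b c → a :* (b :+ k :* c) := a :* b :+ k :* (a :* c)) refl a k _ _)
        ω-lin : ∀ a → IsFunctional (λ x → ω a (δ′ x))
        ω-lin a k x y = trans (ω-congʳ a (δ′-lin k x y)) (ω-linear k a _ _)
        split : ∀ a b c → a ≈ ((a - b) - c) +ᴷ (c +ᴷ b)
        split = solve 3 (λ a b c → a := ((a :- b) :- c) :+ (c :+ b)) refl

        T₁ T₂ : X → Set (c ⊔ ℓ)
        T₁ x = T x × δz x ≈ 0#
        T₂ x = T₁ x × δx x ≈ 0#
        closed₁ : Closed T₁
        closed₁ = kernel-closed {T} δz-lin closed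
        closed₂ : Closed T₂
        closed₂ = kernel-closed {T₁} δx-lin closed₁
        rec = all m T₂ closed₂ δ′ ψ δ′-lin ψ-lin
                λ x ((t , p) , q) e → h x t (join (δ x) p q e)
        ψ₁ : X → Carrier
        ψ₁ x = ψ x - ω (proj₁ rec) (δ′ x)
        ψ₁-lin : IsFunctional ψ₁
        ψ₁-lin = minus-lin ψ-lin (ω-lin (proj₁ rec))
        first = one T₁ closed₁ δx ψ₁ δx-lin ψ₁-lin
                  λ x t q → x≈y⇒x∙y⁻¹≈ε (proj₂ rec x (t , q))
        β = proj₁ first
        ψ₂ : X → Carrier
        ψ₂ x = ψ₁ x - β * δx x
        second = one T closed δz ψ₂ δz-lin (minus-lin ψ₁-lin (scale-lin β δx-lin))
                   λ x t p → x≈y⇒x∙y⁻¹≈ε (proj₂ first x (t , p))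
        α = proj₁ second

    ∘-coisotropic : ∀ {n m k} {S : Relation m k} {R : Relation n m} →
                    IsLinear S → IsLinear R →
                    IsCoisotropic S → IsCoisotropic R → IsCoisotropic (S ∘ᴿ R)
    ∘-coisotropic {n} {m} {k} {S} {R} ls lr s r y₁ y₂ h = a ,
      r y₁ a (perp⁺ R y₁ a λ u v p →
        trans (clear y₁ y₂ u) (trans (proj₂ dual (u , v , 𝟎 , 𝟎) (p , S.𝟎-closed))
        (trans (ω-⊖ a v 𝟎) (sym (clear a a v))))) ,
      s a y₂ (perp⁺ S a y₂ λ v w q → -‿injective (
        trans (clear′ a a v) (trans (sym (ω-⊖ a 𝟎 v))
        (trans (sym (proj₂ dual (𝟎 , 𝟎 , v , w) (R.𝟎-closed , q))) (sym (clear′ y₁ y₂ w))))))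
      where
      module S = IsLinear ls
      module R = IsLinear lr
      clear : ∀ {n m} (x : Phase n) (y : Phase m) v → ω x v ≈ ω x v - ω y 𝟎
      clear x y v = trans (solve 1 (λ a → a := a :- 𝟘) refl (ω x v))
                          (+-congˡ (-‿cong (sym (ω-𝟎ʳ y))))
      clear′ : ∀ {n m} (x : Phase n) (y : Phase m) v → - ω y v ≈ ω x 𝟎 - ω y v
      clear′ x y v = trans (sym (+-identityˡ _)) (+-congʳ (sym (ω-𝟎ʳ x)))
      X = Phase n × Phase m × Phase m × Phase k
      comb : Carrier → X → X → X
      comb μ (a , b , b₁ , a₁) (a′ , b′ , b₁′ , a₁′) =
        a ⊕ μ · a′ , b ⊕ μ · b′ , b₁ ⊕ μ · b₁′ , a₁ ⊕ μ · a₁′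
      dual = Duality.all comb m
        (λ (u , v , v′ , w) → holds R u v × holds S v′ w)
        (λ μ (p , q) (p′ , q′) → R.⊕-closed p (R.·-closed μ p′) , S.⊕-closed q (S.·-closed μ q′))
        (λ (u , v , v′ , w) → v ⊖ v′)
        (λ (u , v , v′ , w) → ω y₁ u - ω y₂ w)
        (λ μ (_ , b , c , _) (_ , b′ , c′ , _) → ⊖-linear μ b c b′ c′)
        (λ μ (a , _ , _ , b) (a′ , _ , _ , b′) →
          trans (+-cong (ω-linear μ y₁ a a′) (-‿cong (ω-linear μ y₂ b b′)))
          (solve 5 (λ a b c d k → (a :+ k :* b) :- (c :+ k :* d) := (a :- c) :+ k :* (b :- d)) refl
            (ω y₁ a) (ω y₁ a′) (ω y₂ b) (ω y₂ b′) μ))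
        (λ (u , v , v′ , w) (p , q) e → h u w (v , p , resp S (≋-sym (⊖≋𝟎⇒≋ v v′ e)) ≋-refl q))
      a = proj₁ dual

    coisotropic-closed : IsSubPROP RelPROP LinearCoisotropic
    coisotropic-closed = record
      { id-closed = λ n → id-linear n , id-coisotropic n
      ; ∘-closed  = λ (ls , s) (lr , r) → ∘-linear ls lr , ∘-coisotropic ls lr s r
      ; ⊗-closed  = λ (lr , r) (ls , s) → ⊗-linear lr ls , ⊗-coisotropic lr ls r s
      ; σ-closed  = λ n m → σ-linear n m , σ-coisotropic n m
      ; †-closed  = λ {f = R} (lr , r) → †-linear lr , †-coisotropic {R = R} r
      ; η₁-closed = η-linear , η-coisotropic
      ; ε₁-closed = †-linear η-linear , †-coisotropic {R = η₁ᴿ} η-coisotropic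
      }

    lagrangian-closed : IsSubPROP RelPROP LinearLagrangian
    lagrangian-closed = record
      { id-closed = λ n → id-linear n , id-isotropic n , id-coisotropic n
      ; ∘-closed  = λ {f = S} {R} (ls , s , s′) (lr , r , r′) →
          ∘-linear ls lr , ∘-isotropic {S = S} {R} s r , ∘-coisotropic ls lr s′ r′
      ; ⊗-closed  = λ {f = R} {S} (lr , r , r′) (ls , s , s′) →
          ⊗-linear lr ls , ⊗-isotropic {R = R} {S} r s , ⊗-coisotropic lr ls r′ s′
      ; σ-closed  = λ n m → σ-linear n m , σ-isotropic n m , σ-coisotropic n m
      ; †-closed  = λ {f = R} (lr , r , r′) →
          †-linear lr , †-isotropic {R = R} r , †-coisotropic {R = R} r′
      ; η₁-closed = η-linear , η-isotropic , η-coisotropic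
      ; ε₁-closed = †-linear η-linear , †-isotropic {R = η₁ᴿ} η-isotropic , †-coisotropic {R = η₁ᴿ} η-coisotropic
      }

    -- A translate of a linear relation may be based at any of its points.
    rebase : ∀ {n m} {R S : Relation n m} {p q} → IsLinear S → R ≐ translate p q S →
             ∀ {a b} → holds R a b → R ≐ translate a b S
    rebase {S = S} {p} {q} ls (f , g) {a} {b} r =
      (λ v w r′ → resp S (⊖-rebase v a p) (⊖-rebase w b q)
        (⊕-closed (f v w r′) (·-closed (- 1#) (f a b r)))) ,
      (λ v w s → g v w (resp S (⊖-chain v a p) (⊖-chain w b q) (⊕-closed s (f a b r))))
      where open IsLinear ls

    module _ (Q : ∀ {n m} → Relation n m → Set (c ⊔ ℓ))
             (linear : ∀ {n m} {R : Relation n m} → Q R → IsLinear R)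
             (Q-closed : IsSubPROP RelPROP Q) where
      module Q = IsSubPROP Q-closed

      ∘-affine : ∀ {n m k} {S : Relation m k} {R : Relation n m} →
                 Affine Q S → Affine Q R → Affine Q (S ∘ᴿ R)
      ∘-affine (inj₁ s) _        = inj₁ λ { u w (v , _ , b) → s v w b }
      ∘-affine (inj₂ _) (inj₁ r) = inj₁ λ { u w (v , a , _) → r u v a }
      ∘-affine {S = S} {R} (inj₂ (_ , _ , S₀ , s , es)) (inj₂ (_ , _ , R₀ , r , er))
        with em {∃[ u ] ∃[ w ] holds (S ∘ᴿ R) u w}
      ... | no none = inj₁ λ u w h → none (u , w , h)
      ... | yes (u , w , v , a , b) = inj₂ (u , w , S₀ ∘ᴿ R₀ , Q.∘-closed s r ,
          (λ u′ w′ (v′ , a′ , b′) → v′ ⊖ v , proj₁ er′ u′ v′ a′ , proj₁ es′ v′ w′ b′) ,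
          (λ u′ w′ (x , a′ , b′) → x ⊕ v ,
            proj₂ er′ u′ (x ⊕ v) (resp R₀ ≋-refl (≋-sym (⊕-⊖ x v)) a′) ,
            proj₂ es′ (x ⊕ v) w′ (resp S₀ (≋-sym (⊕-⊖ x v)) ≋-refl b′)))
        where
        er′ = rebase {R = R} {R₀} (linear r) er a
        es′ = rebase {R = S} {S₀} (linear s) es b

      ⊗-affine : ∀ {n m n′ m′} {R : Relation n m} {S : Relation n′ m′} →
                 Affine Q R → Affine Q S → Affine Q (R ⊗ᴿ S)
      ⊗-affine (inj₁ r) _        = inj₁ λ { v w (a , _) → r _ _ a }
      ⊗-affine (inj₂ _) (inj₁ s) = inj₁ λ { v w (_ , b) → s _ _ b }
      ⊗-affine {n} {m} {R = R} {S} (inj₂ (p , q , R₀ , r , er)) (inj₂ (p′ , q′ , S₀ , s , es)) =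
        inj₂ (p ++ p′ , q ++ q′ , R₀ ⊗ᴿ S₀ , Q.⊗-closed r s ,
          (λ v w (a , b) →
            resp R₀ (≋-sym (take-⊖ n v p p′)) (≋-sym (take-⊖ m w q q′)) (proj₁ er _ _ a) ,
            resp S₀ (≋-sym (drop-⊖ n v p p′)) (≋-sym (drop-⊖ m w q q′)) (proj₁ es _ _ b)) ,
          (λ v w (a , b) →
            proj₂ er _ _ (resp R₀ (take-⊖ n v p p′) (take-⊖ m w q q′) a) ,
            proj₂ es _ _ (resp S₀ (drop-⊖ n v p p′) (drop-⊖ m w q q′) b)))
        where
        take-⊖ : ∀ n {m} (v : Phase (n + m)) (a : Phase n) (b : Phase m) →
                 take n (v ⊖ (a ++ b)) ≋ take n v ⊖ a
        take-⊖ n v a b = ≋-trans (≋-reflexive (take-zipWith _ v (a ++ b)))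
                                 (⊖-cong ≋-refl (take-++ a b))
        drop-⊖ : ∀ n {m} (v : Phase (n + m)) (a : Phase n) (b : Phase m) →
                 drop n (v ⊖ (a ++ b)) ≋ drop n v ⊖ b
        drop-⊖ n v a b = ≋-trans (≋-reflexive (drop-zipWith {m = n} _ v (a ++ b)))
                                 (⊖-cong ≋-refl (drop-++ a b))

      †-affine : ∀ {n m} {R : Relation n m} → Affine Q R → Affine Q (R †ᴿ)
      †-affine (inj₁ r)                       = inj₁ λ w v → r v w
      †-affine (inj₂ (p , q , R₀ , r , f , g)) =
        inj₂ (q , p , R₀ †ᴿ , Q.†-closed r , (λ w v → f v w) , (λ w v → g v w))

      affine-closed : IsSubPROP RelPROP (Affine Q)
      affine-closed = record
        { id-closed = λ n → Linear⇒Affine {Q = Q} (Q.id-closed n)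
        ; ∘-closed  = λ {f = S} {R} → ∘-affine {S = S} {R}
        ; ⊗-closed  = λ {f = R} {S} → ⊗-affine {R = R} {S}
        ; σ-closed  = λ n m → Linear⇒Affine {Q = Q} (Q.σ-closed n m)
        ; †-closed  = λ {f = R} → †-affine {R = R}
        ; η₁-closed = Linear⇒Affine {Q = Q} Q.η₁-closed
        ; ε₁-closed = Linear⇒Affine {Q = Q} Q.ε₁-closed
        }

------------------------------------------------------------------------
-- The four props of relations.  Excluded middle is needed for these
-- classes of relations to be closed under composition.

module Relations {c ℓ} (em : ExcludedMiddle (c ⊔ ℓ)) (K : Field c ℓ) where
  open PhaseSpace K

  LR : DaggerCompactPROP (suc (c ⊔ ℓ)) (c ⊔ ℓ)
  LR = SubPROP RelPROP LinearLagrangian (lagrangian-closed em)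

  CR : DaggerCompactPROP (suc (c ⊔ ℓ)) (c ⊔ ℓ)
  CR = SubPROP RelPROP LinearCoisotropic (coisotropic-closed em)

  ALR : DaggerCompactPROP (suc (c ⊔ ℓ)) (c ⊔ ℓ)
  ALR = SubPROP RelPROP AffineLagrangian
    (affine-closed em LinearLagrangian proj₁ (lagrangian-closed em))

  ACR : DaggerCompactPROP (suc (c ⊔ ℓ)) (c ⊔ ℓ)
  ACR = SubPROP RelPROP AffineCoisotropic
    (affine-closed em LinearCoisotropic proj₁ (coisotropic-closed em))

  module LR  = DaggerCompactPROP LR
  module CR  = DaggerCompactPROP CR
  module ALR = DaggerCompactPROP ALR
  module ACR = DaggerCompactPROP ACR

  LR⊆CR : ∀ {n m} → LR.Hom n m → CR.Hom n m
  LR⊆CR (R , r) = R , Lagrangian⇒Coisotropic r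

  ALR⊆ACR : ∀ {n m} → ALR.Hom n m → ACR.Hom n m
  ALR⊆ACR (R , r) = R , Affine-map {LinearLagrangian} {LinearCoisotropic} Lagrangian⇒Coisotropic {R = R} r

  discardᶜ : CR.Hom 1 0
  discardᶜ = discardᴿ , discard-coisotropic

  discardᵃ : ACR.Hom 1 0
  discardᵃ = discardᴿ , Linear⇒Affine {LinearCoisotropic} discard-coisotropic

{-# OPTIONS --safe #-}

-- By naturality and monoidality every arrow of the discard construction has
-- the form (d^⊗ k ⊗ id) ∘ L with L Lagrangian, so L purifies the coisotropic
-- relation R obtained by forgetting the first k outputs of L.  Symplectic
-- Gram–Schmidt gives a linear map φ from a linear coisotropic R onto some
-- K²ᵏ which preserves the form, and its graph is a purification of R that
-- involves every vector of K²ᵏ.  Any other purification M of R is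
-- (W ⊗ id) ∘ L, where W relates u to u′ if some (v , w) is related to u by L
-- and to u′ by M; W is an isometry, so the discard equations identify M
-- with L.  Affine relations are translates of linear ones, and an empty
-- relation purifies itself, any Lagrangian state serving as W.
module Submission where

open import Defs
open import Level using (_⊔_)
open import Axiom.ExcludedMiddle using (ExcludedMiddle)
open import Data.Nat.Base using (ℕ; zero; suc; _+_; _*_)
open import Data.Nat.Properties using (+-assoc; +-identityʳ)
open import Data.Product.Base using (Σ; Σ-syntax; ∃-syntax; _×_; _,_; proj₁; proj₂)
open import Data.Sum.Base using (inj₁; inj₂)
open import Data.Vec.Base as Vec using (Vec; []; _∷_; _++_; head; tail; take; drop)
open import Data.Vec.Properties using (take-zipWith; drop-zipWith)
open import Data.Vec.Relation.Unary.All using (All; []; _∷_)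
import Data.Vec.Relation.Unary.All.Properties as All
open import Relation.Binary.Bundles using (Setoid)
open import Relation.Binary.Structures using (IsEquivalence)
open import Relation.Binary.PropositionalEquality.Core as ≡ using (_≡_; subst₂)
open import Relation.Nullary.Decidable.Core using (yes; no)
open import Relation.Nullary.Negation.Core using (¬_; contradiction)
import Algebra.Properties.Ring
import Relation.Binary.Reasoning.Setoid as SetoidReasoning

-- Normal forms in the discard construction.

module NormalForm {o e} (C : DaggerCompactPROP o e) where
  private module C = DaggerCompactPROP C
  open Discard C hiding (Disc; arr; d)

  homSetoid : ℕ → ℕ → Setoid o (o ⊔ e)
  homSetoid n m = record { isEquivalence = PROP.isEquivalence (Disc C) {n} {m} }

  private module R {n m} = SetoidReasoning (homSetoid n m)
  open R

  purge : ∀ k m → Arrow (k + m) m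
  purge k m = d^⊗ k ⊗ arr (C.id m)

  ⊗-idᴬ : ∀ n m → arr (C.id n) ⊗ arr (C.id m) ≈ arr (C.id (n + m))
  ⊗-idᴬ = PROP.⊗-id (Disc C)

  ∘-cast : ∀ {n m m′ k} (p : m ≡ m′) (f : Arrow m k) (g : C.Hom n m) →
           f ∘ arr g ≈ subst₂ Arrow p ≡.refl f ∘ arr (C.cast ≡.refl p g)
  ∘-cast ≡.refl f g = refl

  cast-congˡ : ∀ {n n′ m} (p : n ≡ n′) {f g : Arrow n m} → f ≈ g →
               subst₂ Arrow p ≡.refl f ≈ subst₂ Arrow p ≡.refl g
  cast-congˡ ≡.refl f≈g = f≈g

  d^⊗-+ : ∀ k l → d^⊗ k ⊗ d^⊗ l ≈ d^⊗ (k + l)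
  d^⊗-+ zero    l = ⊗-identityˡ (d^⊗ l)
  d^⊗-+ (suc k) l = trans (⊗-assoc d (d^⊗ k) (d^⊗ l)) (⊗-cong refl (d^⊗-+ k l))

  purge-∘ : ∀ k l m → purge l m ∘ purge k (l + m) ≈
            subst₂ Arrow (+-assoc k l m) ≡.refl (purge (k + l) m)
  purge-∘ k l m = begin
    purge l m ∘ purge k (l + m)
      ≈⟨ ∘-cong (⊗-identityˡ (purge l m)) refl ⟨
    (arr (C.id 0) ⊗ purge l m) ∘ (d^⊗ k ⊗ arr (C.id (l + m)))
      ≈⟨ interchange _ _ _ _ ⟨
    (arr (C.id 0) ∘ d^⊗ k) ⊗ (purge l m ∘ arr (C.id (l + m)))
      ≈⟨ ⊗-cong (identityˡ _) (identityʳ _) ⟩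
    d^⊗ k ⊗ (d^⊗ l ⊗ arr (C.id m))
      ≈⟨ ⊗-assoc (d^⊗ k) (d^⊗ l) (arr (C.id m)) ⟨
    subst₂ Arrow (+-assoc k l m) ≡.refl ((d^⊗ k ⊗ d^⊗ l) ⊗ arr (C.id m))
      ≈⟨ cast-congˡ (+-assoc k l m) (⊗-cong (d^⊗-+ k l) refl) ⟩
    subst₂ Arrow (+-assoc k l m) ≡.refl (purge (k + l) m) ∎

  -- By interchange both sides equal `d^⊗ k ⊗ arr f`. This is how discards are moved past later
  -- arrows to the end of a composite.
  purge-natural : ∀ k {n m} (f : C.Hom n m) →
                  arr f ∘ purge k n ≈ purge k m ∘ arr (C.id k C.⊗ f)
  purge-natural k {n} {m} f = begin
    arr f ∘ purge k n
      ≈⟨ ∘-cong (⊗-identityˡ (arr f)) refl ⟨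
    (arr (C.id 0) ⊗ arr f) ∘ (d^⊗ k ⊗ arr (C.id n))
      ≈⟨ interchange _ _ _ _ ⟨
    (arr (C.id 0) ∘ d^⊗ k) ⊗ (arr f ∘ arr (C.id n))
      ≈⟨ ⊗-cong (trans (identityˡ _) (sym (identityʳ _))) (trans (identityʳ _) (sym (identityˡ _))) ⟩
    (d^⊗ k ∘ arr (C.id k)) ⊗ (arr (C.id m) ∘ arr f)
      ≈⟨ interchange _ _ _ _ ⟩
    purge k m ∘ (arr (C.id k) ⊗ arr f)
      ≈⟨ ∘-cong refl (arr-⊗ _ _) ⟨
    purge k m ∘ arr (C.id k C.⊗ f) ∎

  purge-⊗-id : ∀ k m p → subst₂ Arrow (+-assoc k m p) ≡.refl (purge k m ⊗ arr (C.id p)) ≈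
               purge k (m + p)
  purge-⊗-id k m p = trans (⊗-assoc (d^⊗ k) (arr (C.id m)) (arr (C.id p))) (⊗-cong refl (⊗-idᴬ m p))

  -- Interchange brings the discards face to face with `W` alone, and the equation `discard` absorbs
  -- it. This is the step that makes two purifications of one relation equal.
  purge-isometry : ∀ {k l n m} (W : C.Hom k l) → C.IsIsometry W → (L : C.Hom n (k + m)) →
                   purge l m ∘ arr ((W C.⊗ C.id m) C.∘ L) ≈ purge k m ∘ arr L
  purge-isometry {k} {l} {n} {m} W isometry L = begin
    purge l m ∘ arr ((W C.⊗ C.id m) C.∘ L)
      ≈⟨ ∘-cong refl (trans (arr-∘ _ _) (∘-cong (arr-⊗ _ _) refl)) ⟩
    purge l m ∘ ((arr W ⊗ arr (C.id m)) ∘ arr L)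
      ≈⟨ assoc _ _ _ ⟨
    (purge l m ∘ (arr W ⊗ arr (C.id m))) ∘ arr L
      ≈⟨ ∘-cong (interchange _ _ _ _) refl ⟨
    ((d^⊗ l ∘ arr W) ⊗ (arr (C.id m) ∘ arr (C.id m))) ∘ arr L
      ≈⟨ ∘-cong (⊗-cong (discard W isometry) (identityˡ _)) refl ⟩
    purge k m ∘ arr L ∎

  HasNormalForm : ∀ {n m} → Arrow n m → Set (o ⊔ e)
  HasNormalForm {n} {m} f = Σ[ k ∈ ℕ ] Σ[ L ∈ C.Hom n (k + m) ] f ≈ purge k m ∘ arr L

  nf-resp : ∀ {n m} {f g : Arrow n m} → f ≈ g → HasNormalForm g → HasNormalForm f
  nf-resp f≈g (k , L , e) = k , L , trans f≈g e

  nf-arr : ∀ {n m} (f : C.Hom n m) → HasNormalForm (arr f)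
  nf-arr {n} {m} f = 0 , f , sym (trans (∘-cong (⊗-idᴬ 0 m) refl) (identityˡ (arr f)))

  nf-d : HasNormalForm d
  -- Two right unit laws are needed: one for the `id 0` of `purge`, one for the `id 0` that ends
  -- `d^⊗ 1`.
  nf-d = 1 , C.id 1 , sym (trans (identityʳ (purge 1 0))
    (trans (⊗-identityʳ (d ⊗ arr (C.id 0))) (⊗-identityʳ d)))

  nf-∘ : ∀ {n m p} {f : Arrow m p} {g : Arrow n m} →
         HasNormalForm f → HasNormalForm g → HasNormalForm (f ∘ g)
  nf-∘ {n} {m} {p} {f} {g} (k , L , e) (k′ , L′ , e′) =
    -- `L′` acts first, and its `k′` discarded outputs are carried past `L` by `id k′ ⊗ L`, so they
    -- precede the `k` of `L`.
    k′ + k , C.cast ≡.refl (≡.sym a) M , (begin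
      f ∘ g
        ≈⟨ ∘-cong e e′ ⟩
      (purge k p ∘ arr L) ∘ (purge k′ m ∘ arr L′)
        ≈⟨ trans (assoc _ _ _) (∘-cong refl (sym (assoc _ _ _))) ⟩
      purge k p ∘ ((arr L ∘ purge k′ m) ∘ arr L′)
        ≈⟨ ∘-cong refl (trans (∘-cong (purge-natural k′ L) refl) (assoc _ _ _)) ⟩
      purge k p ∘ (purge k′ (k + p) ∘ (arr (C.id k′ C.⊗ L) ∘ arr L′))
        ≈⟨ ∘-cong refl (∘-cong refl (arr-∘ _ _)) ⟨
      purge k p ∘ (purge k′ (k + p) ∘ arr M)
        ≈⟨ assoc _ _ _ ⟨
      (purge k p ∘ purge k′ (k + p)) ∘ arr M
        ≈⟨ ∘-cong (purge-∘ k′ k p) refl ⟩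
      subst₂ Arrow a ≡.refl (purge (k′ + k) p) ∘ arr M
        ≈⟨ uncast a ⟩
      purge (k′ + k) p ∘ arr (C.cast ≡.refl (≡.sym a) M) ∎)
    where
    a = +-assoc k′ k p
    M = (C.id k′ C.⊗ L) C.∘ L′
    uncast : ∀ {n m m′ k} (q : m ≡ m′) {f : Arrow m k} {g : C.Hom n m′} →
             subst₂ Arrow q ≡.refl f ∘ arr g ≈ f ∘ arr (C.cast ≡.refl (≡.sym q) g)
    uncast ≡.refl = refl

  nf-⊗-id : ∀ {n m} {f : Arrow n m} p → HasNormalForm f → HasNormalForm (f ⊗ arr (C.id p))
  nf-⊗-id {n} {m} {f} p (k , L , e) = k , C.cast ≡.refl a (L C.⊗ C.id p) , (begin
    f ⊗ arr (C.id p)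
      ≈⟨ ⊗-cong e (sym (identityˡ _)) ⟩
    (purge k m ∘ arr L) ⊗ (arr (C.id p) ∘ arr (C.id p))
      ≈⟨ interchange _ _ _ _ ⟩
    (purge k m ⊗ arr (C.id p)) ∘ (arr L ⊗ arr (C.id p))
      ≈⟨ ∘-cong refl (arr-⊗ _ _) ⟨
    (purge k m ⊗ arr (C.id p)) ∘ arr (L C.⊗ C.id p)
      ≈⟨ ∘-cast a _ _ ⟩
    subst₂ Arrow a ≡.refl (purge k m ⊗ arr (C.id p)) ∘ arr (C.cast ≡.refl a (L C.⊗ C.id p))
      ≈⟨ ∘-cong (purge-⊗-id k m p) refl ⟩
    purge k (m + p) ∘ arr (C.cast ≡.refl a (L C.⊗ C.id p)) ∎)
    where a = +-assoc k m p

  -- Naturality of the symmetry turns `id ⊗ g` into `g ⊗ id`. Normal forms then have to be tensored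
  -- with identities on the right only, where the discarded outputs stay in front.
  ⊗-factor : ∀ {n m n′ m′} (f : Arrow n m) (g : Arrow n′ m′) →
             f ⊗ g ≈ (f ⊗ arr (C.id m′)) ∘ (arr (C.σ m′ n) ∘ ((g ⊗ arr (C.id n)) ∘ arr (C.σ n n′)))
  ⊗-factor {n} {m} {n′} {m′} f g = begin
    f ⊗ g
      ≈⟨ ⊗-cong (identityʳ f) (identityˡ g) ⟨
    (f ∘ arr (C.id n)) ⊗ (arr (C.id m′) ∘ g)
      ≈⟨ interchange _ _ _ _ ⟩
    (f ⊗ arr (C.id m′)) ∘ (arr (C.id n) ⊗ g)
      ≈⟨ ∘-cong refl (trans (∘-cong refl (PROP.σ-involutive (Disc C) n n′)) (identityʳ _)) ⟨
    (f ⊗ arr (C.id m′)) ∘ ((arr (C.id n) ⊗ g) ∘ (arr (C.σ n′ n) ∘ arr (C.σ n n′)))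
      ≈⟨ ∘-cong refl (assoc _ _ _) ⟨
    (f ⊗ arr (C.id m′)) ∘ (((arr (C.id n) ⊗ g) ∘ arr (C.σ n′ n)) ∘ arr (C.σ n n′))
      ≈⟨ ∘-cong refl (∘-cong (σ-natural g (arr (C.id n))) refl) ⟨
    (f ⊗ arr (C.id m′)) ∘ ((arr (C.σ m′ n) ∘ (g ⊗ arr (C.id n))) ∘ arr (C.σ n n′))
      ≈⟨ ∘-cong refl (assoc _ _ _) ⟩
    (f ⊗ arr (C.id m′)) ∘ (arr (C.σ m′ n) ∘ ((g ⊗ arr (C.id n)) ∘ arr (C.σ n n′))) ∎

  normalForm : ∀ {n m} (f : Arrow n m) → HasNormalForm f
  normalForm (arr f) = nf-arr f
  normalForm d       = nf-d
  normalForm (f ∘ g) = nf-∘ (normalForm f) (normalForm g)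
  normalForm (_⊗_ {n} {m} {n′} {m′} f g) = nf-resp (⊗-factor f g)
    (nf-∘ (nf-⊗-id m′ (normalForm f))
      (nf-∘ (nf-arr (C.σ m′ n)) (nf-∘ (nf-⊗-id n (normalForm g)) (nf-arr (C.σ n n′)))))

-- The induced morphism out of the discard construction, and a criterion for it to be an
-- isomorphism.

module Extension {o e o′ e′} (C : DaggerCompactPROP o e) (D : PROP o′ e′)
                 (I : PROPMorphism (DaggerCompactPROP.prop C) D) (dᴰ : PROP.Hom D 1 0) where
  private
    module C = DaggerCompactPROP C
    module D = PROP D
    module I = PROPMorphism I
    module E {n m} = IsEquivalence (D.isEquivalence {n} {m})
  open Discard C hiding (Disc; arr; d)
  open NormalForm C using (purge; purge-isometry; normalForm)

  eval : ∀ {n m} → Arrow n m → D.Hom n m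
  eval (arr f) = I.map-hom f
  eval d       = dᴰ
  eval (f ∘ g) = eval f D.∘ eval g
  eval (f ⊗ g) = eval f D.⊗ eval g

  PreservesDiscarding : Set (o ⊔ e ⊔ e′)
  PreservesDiscarding = ∀ {n m} (H : C.Hom n m) → C.IsIsometry H →
                        eval (d^⊗ m) D.∘ I.map-hom H D.≈ eval (d^⊗ n)

  module _ (eval-discard : PreservesDiscarding) where

    eval-cast : ∀ {n n′ m m′} (p : n ≡ n′) (q : m ≡ m′) (f : Arrow n m) →
                eval (subst₂ Arrow p q f) D.≈ D.cast p q (eval f)
    eval-cast ≡.refl ≡.refl f = E.refl

    cast-cong : ∀ {n n′ m m′} (p : n ≡ n′) (q : m ≡ m′) {f g : D.Hom n m} →
                f D.≈ g → D.cast p q f D.≈ D.cast p q g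
    cast-cong ≡.refl ≡.refl f≈g = f≈g

    eval-cong : ∀ {n m} {f g : Arrow n m} → f ≈ g → eval f D.≈ eval g
    eval-cong refl                    = E.refl
    eval-cong (sym p)                 = E.sym (eval-cong p)
    eval-cong (trans p q)             = E.trans (eval-cong p) (eval-cong q)
    eval-cong (∘-cong p q)            = D.∘-cong (eval-cong p) (eval-cong q)
    eval-cong (identityˡ f)           = E.trans (D.∘-cong (I.map-id _) E.refl) (D.identityˡ _)
    eval-cong (identityʳ f)           = E.trans (D.∘-cong E.refl (I.map-id _)) (D.identityʳ _)
    eval-cong (assoc f g h)           = D.assoc _ _ _
    eval-cong (⊗-cong p q)            = D.⊗-cong (eval-cong p) (eval-cong q)
    eval-cong (interchange f g f′ g′) = D.interchange _ _ _ _
    eval-cong (⊗-assoc {n} {m} {n′} {m′} {n″} {m″} f g h) =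
      E.trans (eval-cast (+-assoc n n′ n″) (+-assoc m m′ m″) _) (D.⊗-assoc _ _ _)
    eval-cong (⊗-identityˡ f)         = E.trans (D.⊗-cong (I.map-id 0) E.refl) (D.⊗-identityˡ _)
    eval-cong (⊗-identityʳ {n} {m} f) =
      E.trans (eval-cast (+-identityʳ n) (+-identityʳ m) _)
      (E.trans (cast-cong (+-identityʳ n) (+-identityʳ m) (D.⊗-cong E.refl (I.map-id 0)))
      (D.⊗-identityʳ _))
    eval-cong (σ-natural f g)         =
      E.trans (D.∘-cong (I.map-σ _ _) E.refl)
      (E.trans (D.σ-natural _ _) (D.∘-cong E.refl (E.sym (I.map-σ _ _))))
    eval-cong (arr-cong p)            = I.map-cong p
    eval-cong (arr-∘ f g)             = I.map-∘ f g
    eval-cong (arr-⊗ f g)             = I.map-⊗ f g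
    eval-cong (discard H isometry)    = eval-discard H isometry

    extension : PROPMorphism (Disc C) D
    extension = record
      { map-hom  = eval
      ; map-cong = eval-cong
      ; map-id   = I.map-id
      ; map-∘    = λ _ _ → E.refl
      ; map-⊗    = λ _ _ → E.refl
      ; map-σ    = I.map-σ
      }

    -- Isometries lead from the chosen `L` to each competitor `M`. Two competitors are compared
    -- through `L`, so no isometry ever has to be inverted.
    record Purification {n m} (R : D.Hom n m) : Set (o ⊔ e ⊔ o′ ⊔ e′) where
      field
        k         : ℕ
        L         : C.Hom n (k + m)
        purifies  : eval (purge k m ∘ arr L) D.≈ R
        universal : ∀ {l} (M : C.Hom n (l + m)) → eval (purge l m ∘ arr M) D.≈ R →
                    Σ[ W ∈ C.Hom k l ] C.IsIsometry W × (M C.≈ (W C.⊗ C.id m) C.∘ L)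

    module _ (purify : ∀ {n m} (R : D.Hom n m) → Purification R) where

      canonical : ∀ {n m} → D.Hom n m → Arrow n m
      canonical {m = m} R = purge k m ∘ arr L
        where open Purification (purify R)

      eval-canonical : ∀ {n m} (R : D.Hom n m) → eval (canonical R) D.≈ R
      eval-canonical R = Purification.purifies (purify R)

      -- The arrow `M` in the normal form of `f` purifies `R`, so it is `L` followed by an isometry
      -- on the discarded outputs, and `purge-isometry` removes that isometry.
      ≈canonical : ∀ {n m} (R : D.Hom n m) (f : Arrow n m) → eval f D.≈ R → f ≈ canonical R
      ≈canonical R f f≈R =
        let (_ , M , f≈M)       = normalForm f
            (W , isometry , eq) = universal M (E.trans (E.sym (eval-cong f≈M)) f≈R)
        in trans f≈M (trans (∘-cong refl (arr-cong eq)) (purge-isometry W isometry L))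
        where open Purification (purify R)

      faithful : ∀ {n m} {f g : Arrow n m} → eval f D.≈ eval g → f ≈ g
      faithful {f = f} {g} f≈g =
        trans (≈canonical (eval g) f f≈g) (sym (≈canonical (eval g) g E.refl))

      -- `canonical` is a section of `eval`, and `faithful` reflects equality, so each law of the
      -- inverse can be checked after applying `eval`.
      extension-isomorphism : IsIsomorphism extension
      extension-isomorphism = record
        { inverse = record
          { map-hom  = canonical
          ; map-cong = λ {f = R} {S} R≈S →
              faithful (E.trans (eval-canonical R) (E.trans R≈S (E.sym (eval-canonical S))))
          ; map-id   = λ n → faithful (E.trans (eval-canonical _) (E.sym (I.map-id n)))
          ; map-∘    = λ R S → faithful (E.trans (eval-canonical _)
              (E.sym (D.∘-cong (eval-canonical R) (eval-canonical S))))
          ; map-⊗    = λ R S → faithful (E.trans (eval-canonical _)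
              (E.sym (D.⊗-cong (eval-canonical R) (eval-canonical S))))
          ; map-σ    = λ n m → faithful (E.trans (eval-canonical _) (E.sym (I.map-σ n m)))
          }
        ; inverseˡ = λ f → faithful (eval-canonical (eval f))
        ; inverseʳ = eval-canonical
        }

-- Symplectic Gram-Schmidt on a subspace.

module SymplecticReduction {c ℓ} (em : ExcludedMiddle (c ⊔ ℓ)) (K : Field c ℓ) where
  open Field K hiding (zero; inverse; +-assoc; +-identityʳ) renaming (_+_ to _+ᴷ_; _*_ to _*ᴷ_)
  open PhaseSpace K
  open RingSolver commutativeRing using (solve; _:+_; _:*_; _:-_; :-_; _:=_)

  ⊕-·-𝟎 : ∀ {n} k (u : Phase n) {w : Phase n} → w ≋ 𝟎 {n} → u ⊕ k · w ≋ u
  ⊕-·-𝟎 k []            []                        = []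
  ⊕-·-𝟎 k ((z , x) ∷ u) {(_ , _) ∷ _} ((p , q) ∷ e) = (f z p , f x q) ∷ ⊕-·-𝟎 k u e
    where
    f : ∀ a {b} → b ≈ 0# → a +ᴷ k *ᴷ b ≈ a
    f a b≈0 = trans (+-congˡ (*-congˡ b≈0)) (solve 2 (λ a k → a :+ k :* 𝟘 := a) refl a k)

  module _ {X : Set c} (comb : Carrier → X → X → X) where
    open Duality em comb using (IsFunctional; Closed)

    Functional : Set (c ⊔ ℓ)
    Functional = Σ (X → Carrier) IsFunctional

    Vanishes : X → Functional → Set ℓ
    Vanishes x (f , _) = f x ≈ 0#

    -- Two functionals for each block K², whence `n * 2`. A finite vector of functionals stands in
    -- for finite dimension, and `reduction` recurses on its length.
    coordinates : ∀ n (π : X → Phase n) → (∀ k x y → π (comb k x y) ≋ π x ⊕ k · π y) →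
                  Vec Functional (n * 2)
    coordinates zero    π π-lin = []
    coordinates (suc n) π π-lin =
      ((λ x → proj₁ (head (π x))) , λ k x y → proj₁ (heads _ _ _ (π-lin k x y))) ∷
      ((λ x → proj₂ (head (π x))) , λ k x y → proj₂ (heads _ _ _ (π-lin k x y))) ∷
      coordinates n (λ x → tail (π x)) (λ k x y → tails _ _ _ (π-lin k x y))
      where
      heads : ∀ {k} (u v w : Phase (suc n)) → u ≋ v ⊕ k · w →
              (proj₁ (head u) ≈ proj₁ (head v) +ᴷ k *ᴷ proj₁ (head w)) ×
              (proj₂ (head u) ≈ proj₂ (head v) +ᴷ k *ᴷ proj₂ (head w))
      heads (_ ∷ _) (_ ∷ _) (_ ∷ _) (p ∷ _) = p
      tails : ∀ {k} (u v w : Phase (suc n)) → u ≋ v ⊕ k · w → tail u ≋ tail v ⊕ k · tail w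
      tails (_ ∷ _) (_ ∷ _) (_ ∷ _) (_ ∷ e) = e

    coordinates-separate : ∀ n π π-lin {x} → All (Vanishes x) (coordinates n π π-lin) → π x ≋ 𝟎 {n}
    coordinates-separate zero    π π-lin {x} [] = empty (π x)
      where
      empty : (v : Phase 0) → v ≋ 𝟎 {0}
      empty [] = []
    coordinates-separate (suc n) π π-lin {x} (p ∷ q ∷ r) =
      join (π x) p q (coordinates-separate n _ _ r)
      where
      join : (v : Phase (suc n)) → proj₁ (head v) ≈ 0# → proj₂ (head v) ≈ 0# →
             tail v ≋ 𝟎 {n} → v ≋ 𝟎 {suc n}
      join (_ ∷ _) p q e = (p , q) ∷ e

    module _ (B : X → X → Carrier) (B-linˡ : ∀ y → IsFunctional (λ x → B x y))
             (B-skew : ∀ x y → B x y ≈ - B y x) (B-alt : ∀ x → B x x ≈ 0#) where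

      B-linʳ : ∀ x → IsFunctional (B x)
      B-linʳ x k y z = trans (B-skew x _) (trans (-‿cong (B-linˡ x k y z))
        (trans (solve 3 (λ a k b → :- (a :+ k :* b) := :- a :+ k :* :- b) refl (B y x) k (B z x))
        (+-cong (sym (B-skew x y)) (*-congˡ (sym (B-skew x z))))))

      -- The quotient of `T` by its radical, identified with K²ᵏ. Since `φ` lives on all of `X`,
      -- `φ-perp` can ask it to vanish on the whole orthogonal of `T`; `extend` applies this to a
      -- hyperbolic pair, which lies outside the complement being reduced.
      record Reduction (T : X → Set (c ⊔ ℓ)) : Set (c ⊔ ℓ) where
        field
          k       : ℕ
          φ       : X → Phase k
          φ-lin   : ∀ μ x y → φ (comb μ x y) ≋ φ x ⊕ μ · φ y
          φ-perp  : ∀ x → (∀ t → T t → B x t ≈ 0#) → φ x ≋ 𝟎 {k}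
          φ-onto  : ∀ (u : Phase k) → ∃[ t ] T t × φ t ≋ u
          φ-pres  : ∀ t s → T t → T s → ω (φ t) (φ s) ≈ B t s

      -- Weaker than separating points: it bounds by `n` the dimension of `T` modulo its radical.
      Separates : ∀ {n} → Vec Functional n → (X → Set (c ⊔ ℓ)) → Set (c ⊔ ℓ)
      Separates fs T = ∀ t → T t → All (Vanishes t) fs → ∀ s → T s → B t s ≈ 0#

      module HyperbolicPair (T : X → Set (c ⊔ ℓ)) (closed : Closed T) (x f : X)
                       (x∈T : T x) (f∈T : T f) (Bxf≈1 : B x f ≈ 1#) where

        Complement : X → Set (c ⊔ ℓ)
        Complement t = T t × B t x ≈ 0# × B t f ≈ 0#

        private
          Bfx : B f x ≈ - 1#
          Bfx = trans (B-skew f x) (-‿cong Bxf≈1)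

          kill : ∀ μ {a b} → a ≈ 0# → b ≈ 0# → a +ᴷ μ *ᴷ b ≈ 0#
          kill μ p q = trans (+-cong p (*-congˡ q)) (solve 1 (λ k → 𝟘 :+ k :* 𝟘 := 𝟘) refl μ)

        complement-closed : Closed Complement
        complement-closed μ (t , p , q) (s , p′ , q′) =
          closed μ t s , trans (B-linˡ x μ _ _) (kill μ p p′) , trans (B-linˡ f μ _ _) (kill μ q q′)

        shift : Carrier → Carrier → X → X
        shift a b t = comb b (comb a t x) f

        shift∈T : ∀ a b {t} → T t → T (shift a b t)
        shift∈T a b t∈T = closed b (closed a t∈T x∈T) f∈T

        B-shift : ∀ a b t s → B (shift a b t) s ≈ (B t s +ᴷ a *ᴷ B x s) +ᴷ b *ᴷ B f s
        B-shift a b t s = trans (B-linˡ s b _ _) (+-congʳ (B-linˡ s a _ _))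

        B-shift-x : ∀ a b t → B (shift a b t) x ≈ B t x - b
        B-shift-x a b t = trans (B-shift a b t x) (trans (+-cong (+-congˡ (*-congˡ (B-alt x))) (*-congˡ Bfx))
          (solve 3 (λ p a b → (p :+ a :* 𝟘) :+ b :* :- 𝟙 := p :- b) refl _ a b))

        B-shift-f : ∀ a b t → B (shift a b t) f ≈ B t f +ᴷ a
        B-shift-f a b t = trans (B-shift a b t f) (trans (+-cong (+-congˡ (*-congˡ Bxf≈1)) (*-congˡ (B-alt f)))
          (solve 3 (λ p a b → (p :+ a :* 𝟙) :+ b :* 𝟘 := p :+ a) refl _ a b))

        -- Since `B x f` is 1, these coefficients cancel the pairings of `t` with `x` and `f`.
        project : X → X
        project t = shift (- B t f) (B t x) t

        project∈ : ∀ {t} → T t → Complement (project t)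
        project∈ {t} t∈T = shift∈T _ _ t∈T ,
          trans (B-shift-x _ _ t) (-‿inverseʳ _) , trans (B-shift-f _ _ t) (-‿inverseʳ _)

        complement⊥x : ∀ {t} → Complement t → B x t ≈ 0#
        complement⊥x (_ , p , _) = trans (B-skew x _) (trans (-‿cong p) (solve 0 (:- 𝟘 := 𝟘) refl))

        complement⊥f : ∀ {t} → Complement t → B f t ≈ 0#
        complement⊥f (_ , _ , q) = trans (B-skew f _) (trans (-‿cong q) (solve 0 (:- 𝟘 := 𝟘) refl))

        -- `T` is the plane of `x` and `f` plus its complement. The new block `(B t f , - B t x)`
        -- sends `x` to `(1 , 0)` and `f` to `(0 , 1)`, while the old `φ` vanishes on the plane.
        extend : Reduction Complement → Reduction T
        extend red = record
          { k      = suc k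
          ; φ      = φ⁺
          ; φ-lin  = λ μ t s →
              (B-linˡ f μ t s , trans (-‿cong (B-linˡ x μ t s))
                 (solve 3 (λ a k b → :- (a :+ k :* b) := :- a :+ k :* :- b) refl _ μ _)) ∷ φ-lin μ t s
          ; φ-perp = λ t h → (h f f∈T , trans (-‿cong (h x x∈T)) (solve 0 (:- 𝟘 := 𝟘) refl)) ∷
                             φ-perp t λ s (s∈T , _) → h s s∈T
          -- A preimage of `u` in the complement has zero new coordinates. Adding `a x + b f` makes
          -- them `(a , b)` and leaves `φ` unchanged.
          ; φ-onto = λ { ((a , b) ∷ u) → let (t , (t∈T , p , q) , r) = φ-onto u in
              shift a b t , shift∈T a b t∈T ,
              (trans (B-shift-f a b t) (trans (+-congʳ q) (+-identityˡ a)) ,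
               trans (-‿cong (trans (B-shift-x a b t) (+-congʳ p)))
                 (solve 1 (λ b → :- (𝟘 :- b) := b) refl b)) ∷
              ≋-trans (φ-shift a b t) r }
          ; φ-pres = λ t s t∈T s∈T → trans (+-congˡ (φ-pres⁺ t s t∈T s∈T))
              (solve 5 (λ tf tx sf sx b →
                 (tf :* :- sx :- :- tx :* sf) :+ ((b :+ :- sf :* tx) :+ sx :* tf) := b)
                 refl (B t f) (B t x) (B s f) (B s x) (B t s))
          }
          where
          open Reduction red
          φ⁺ : X → Phase (suc k)
          φ⁺ t = (B t f , - B t x) ∷ φ t
          φ-shift : ∀ a b t → φ (shift a b t) ≋ φ t
          φ-shift a b t = ≋-trans (φ-lin b _ f) (≋-trans (⊕-·-𝟎 b _ (φ-perp f λ _ → complement⊥f))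
            (≋-trans (φ-lin a t x) (⊕-·-𝟎 a _ (φ-perp x λ _ → complement⊥x))))
          B-project : ∀ t s → B t (project s) ≈ (B t s +ᴷ - B s f *ᴷ B t x) +ᴷ B s x *ᴷ B t f
          B-project t s = trans (B-linʳ t _ _ _) (+-congʳ (B-linʳ t _ _ _))
          -- As `φ` ignores the plane, both arguments may be projected to the complement, where
          -- `φ-pres` applies. The two correction terms are what the new block of `ω` cancels.
          φ-pres⁺ : ∀ t s → T t → T s →
                    ω (φ t) (φ s) ≈ (B t s +ᴷ - B s f *ᴷ B t x) +ᴷ B s x *ᴷ B t f
          φ-pres⁺ t s t∈T s∈T =
            trans (ω-cong (≋-sym (φ-shift _ _ t)) (≋-sym (φ-shift _ _ s)))
            (trans (φ-pres _ _ (project∈ t∈T) (project∈ s∈T))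
            (trans (B-shift _ _ t (project s))
            (trans (+-cong (+-congˡ (*-congˡ (complement⊥x (project∈ s∈T)))) (*-congˡ (complement⊥f (project∈ s∈T))))
            (trans (solve 3 (λ p a b → (p :+ a :* 𝟘) :+ b :* 𝟘 := p) refl _ _ _)
            (B-project t s)))))

      -- Here i is to be the inverse of f₀ x₀, so that the result vanishes at x₀.
      eliminate : Functional → X → Carrier → Functional → Functional
      eliminate (f₀ , f₀-lin) x₀ i (f , f-lin) =
        (λ x → f x - f x₀ *ᴷ (i *ᴷ f₀ x)) ,
        λ k x y → trans (+-cong (f-lin k x y) (-‿cong (*-congˡ (*-congˡ (f₀-lin k x y)))))
          (solve 7 (λ a k b p i q r → (a :+ k :* b) :- p :* (i :* (q :+ k :* r)) :=
                                      (a :- p :* (i :* q)) :+ k :* (b :- p :* (i :* r)))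
            refl _ k _ _ i _ _)

      -- Each step removes a functional: the pivot f₀ is dropped if it vanishes
      -- on T, and eliminated along y otherwise.  If y is not in the radical
      -- of T, it is completed to a hyperbolic pair, which is split off T.
      reduction : ∀ {n} (fs : Vec Functional n) (T : X → Set (c ⊔ ℓ)) → Closed T →
                  ∃[ t ] T t → Separates fs T → Reduction T
      reduction [] T closed (t₀ , t₀∈T) sep = record
        { k = 0 ; φ = λ _ → [] ; φ-lin = λ _ _ _ → [] ; φ-perp = λ _ _ → []
        ; φ-onto = λ { [] → t₀ , t₀∈T , [] } ; φ-pres = λ t s t∈T s∈T → sym (sep t t∈T [] s s∈T) }
      reduction ((f₀ , f₀-lin) ∷ fs) T closed (t₀ , t₀∈T) sep
        with em {∃[ y ] T y × ¬ (f₀ y ≈ 0#)}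
      ... | no none = reduction fs T closed (t₀ , t₀∈T) λ t t∈T v → sep t t∈T (f₀≈0 t t∈T ∷ v)
        where
        f₀≈0 : ∀ t → T t → f₀ t ≈ 0#
        f₀≈0 t t∈T with em-≈ em (f₀ t) 0#
        ... | yes p = p
        ... | no ¬p = contradiction (t , t∈T , ¬p) none
      ... | yes (y , y∈T , f₀y≉0) with Field.inverse K (f₀ y) f₀y≉0
      ... | i , f₀y*i≈1 = step
        where
        fs′ = Vec.map (eliminate (f₀ , f₀-lin) y i) fs

        coeff : X → Carrier
        coeff t = - (i *ᴷ f₀ t)

        -- An eliminated functional takes at `t` the value of the original one at `t + coeff t y`.
        lift-vanishing : ∀ t {n} (gs : Vec Functional n) →
                         All (Vanishes t) (Vec.map (eliminate (f₀ , f₀-lin) y i) gs) →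
                         All (Vanishes (comb (coeff t) t y)) gs
        lift-vanishing t []               []      = []
        lift-vanishing t ((g , g-lin) ∷ gs) (p ∷ v) =
          trans (g-lin _ t y) (trans (solve 3 (λ a b j → a :+ :- j :* b := a :- b :* j) refl _ _ _) p) ∷
          lift-vanishing t gs v

        -- The vector `t + coeff t y` is also killed by `f₀`, because `i` inverts `f₀ y`; hence it
        -- lies in the radical.
        radical : ∀ t → T t → All (Vanishes t) fs′ → ∀ s → T s → B t s +ᴷ coeff t *ᴷ B y s ≈ 0#
        radical t t∈T v s s∈T = trans (sym (B-linˡ s _ t y))
          (sep _ (closed _ t∈T y∈T)
            (trans (f₀-lin _ t y)
              (trans (solve 3 (λ a i b → a :+ :- (i :* a) :* b := a :- a :* (b :* i)) refl (f₀ t) i (f₀ y))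
              (trans (+-congˡ (-‿cong (*-congˡ f₀y*i≈1)))
              (solve 1 (λ a → a :- a :* 𝟙 := 𝟘) refl (f₀ t)))) ∷
             lift-vanishing t fs v)
            s s∈T)

        step : Reduction T
        step with em {∃[ x ] T x × ¬ (B x y ≈ 0#)}
        -- Here `y` is in the radical itself, so correcting `t` by a multiple of `y` changes no
        -- pairing.
        ... | no none = reduction fs′ T closed (t₀ , t₀∈T) λ t t∈T v s s∈T →
          trans (sym (trans (+-congˡ (trans (*-congˡ (y⊥ s s∈T)) (zeroʳ _))) (Field.+-identityʳ K _)))
                (radical t t∈T v s s∈T)
          where
          y⊥ : ∀ s → T s → B y s ≈ 0#
          y⊥ s s∈T with em-≈ em (B s y) 0#
          ... | yes p = trans (B-skew y s) (trans (-‿cong p) (solve 0 (:- 𝟘 := 𝟘) refl))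
          ... | no ¬p = contradiction (s , s∈T , ¬p) none
        ... | yes (x₁ , x₁∈T , Bx₁y≉0) with Field.inverse K (B x₁ y) Bx₁y≉0
        ... | j , Bx₁y*j≈1 = H.extend (reduction fs′ H.Complement H.complement-closed
            (_ , H.project∈ t₀∈T) separates)
          where
          -- This is `j x₁`, written with `comb` as the only operation of `X`; the factor `j`
          -- normalises `B x y` to 1.
          x = comb (j - 1#) x₁ x₁
          x∈T = closed (j - 1#) x₁∈T x₁∈T
          Bxy≈1 : B x y ≈ 1#
          Bxy≈1 = trans (B-linˡ y _ x₁ x₁)
            (trans (solve 2 (λ b j → b :+ (j :- 𝟙) :* b := b :* j) refl (B x₁ y) j) Bx₁y*j≈1)
          module H = HyperbolicPair T closed x y x∈T y∈T Bxy≈1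
          -- The radical vector `t + coeff t y` pairs to zero with `x`. For `t` in the complement
          -- that pairing is `- coeff t`.
          coeff≈0 : ∀ t → H.Complement t → All (Vanishes t) fs′ → coeff t ≈ 0#
          coeff≈0 t (t∈T , p , _) v =
            trans (solve 1 (λ a → a := :- (𝟘 :+ a :* :- 𝟙)) refl (coeff t))
            (trans (-‿cong (trans (sym (+-cong p (*-congˡ (trans (B-skew y x) (-‿cong Bxy≈1)))))
                                  (radical t t∈T v x x∈T)))
            (solve 0 (:- 𝟘 := 𝟘) refl))
          separates : Separates fs′ H.Complement
          separates t t∈@(t∈T , _) v s (s∈T , _) =
            trans (solve 2 (λ b y → b := b :+ 𝟘 :* y) refl (B t s) (B y s))
            (trans (+-congˡ (*-congʳ (sym (coeff≈0 t t∈ v)))) (radical t t∈T v s s∈T))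

-- Algebra of the symplectic form, split outputs and marginals.

module Purifications {c ℓ} (em : ExcludedMiddle (c ⊔ ℓ)) (K : Field c ℓ) where
  open Field K hiding (zero; inverse; +-assoc; +-identityʳ) renaming (_+_ to _+ᴷ_; _*_ to _*ᴷ_)
  open PhaseSpace K
  open RingSolver commutativeRing using (solve; _:+_; _:*_; _:-_; :-_; _:=_)
  open Algebra.Properties.Ring ring using (+-cancelʳ)
  open SymplecticReduction em K

  private module Rel = DaggerCompactPROP RelPROP

  relSetoid : ℕ → ℕ → Setoid _ _
  relSetoid n m = record { isEquivalence = Rel.isEquivalence {n} {m} }

  private
    module R {n m} = SetoidReasoning (relSetoid n m)
    open R

  ≐-refl : ∀ {n m} (R : Relation n m) → R ≐ R
  ≐-refl R = (λ _ _ r → r) , (λ _ _ r → r)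

  ++-take-drop : ∀ n {m} (v : Phase (n + m)) → v ≋ take n v ++ drop n v
  ++-take-drop n v = take-drop-join n (≋-sym (take-++ (take n v) (drop n v)))
                                      (≋-sym (drop-++ (take n v) (drop n v)))

  ω-++-++ : ∀ {n m} (u u′ : Phase n) (w w′ : Phase m) → ω (u ++ w) (u′ ++ w′) ≈ ω u u′ +ᴷ ω w w′
  ω-++-++ u u′ w w′ = trans (ω-++ (u ++ w) u′ w′)
    (+-cong (ω-cong (take-++ u w) (≋-refl {x = u′})) (ω-cong (drop-++ u w) (≋-refl {x = w′})))

  ω-skew : ∀ {n} (v w : Phase n) → ω v w ≈ - ω w v
  ω-skew []            []              = solve 0 (𝟘 := :- 𝟘) refl
  ω-skew ((z , x) ∷ v) ((z′ , x′) ∷ w) = trans (+-congˡ (ω-skew v w))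
    (solve 5 (λ z x z′ x′ s → (z :* x′ :- x :* z′) :+ :- s := :- ((z′ :* x :- x′ :* z) :+ s)) refl z x z′ x′ _)

  ω-alternating : ∀ {n} (v : Phase n) → ω v v ≈ 0#
  ω-alternating []            = refl
  ω-alternating ((z , x) ∷ v) = trans (+-congˡ (ω-alternating v))
    (solve 2 (λ z x → (z :* x :- x :* z) :+ 𝟘 := 𝟘) refl z x)

  ω-linearˡ : ∀ {n} k (a b v : Phase n) → ω (a ⊕ k · b) v ≈ ω a v +ᴷ k *ᴷ ω b v
  ω-linearˡ k a b v = trans (ω-skew _ v) (trans (-‿cong (ω-linear k v a b))
    (trans (solve 3 (λ p k q → :- (p :+ k :* q) := :- p :+ k :* :- q) refl _ k _)
    (+-cong (sym (ω-skew a v)) (*-congˡ (sym (ω-skew b v))))))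

  ω-𝟎ˡ : ∀ {n} (v : Phase n) → ω 𝟎 v ≈ 0#
  ω-𝟎ˡ v = trans (ω-skew 𝟎 v) (trans (-‿cong (ω-𝟎ʳ v)) (solve 0 (:- 𝟘 := 𝟘) refl))

  ω-⊕ˡ : ∀ {n} (a b v : Phase n) → ω (a ⊕ b) v ≈ ω a v +ᴷ ω b v
  ω-⊕ˡ []            []              []              = solve 0 (𝟘 := 𝟘 :+ 𝟘) refl
  ω-⊕ˡ ((z , x) ∷ a) ((z′ , x′) ∷ b) ((z″ , x″) ∷ v) = trans (+-congˡ (ω-⊕ˡ a b v))
    (solve 8 (λ z x z′ x′ z″ x″ s t →
      ((z :+ z′) :* x″ :- (x :+ x′) :* z″) :+ (s :+ t) :=
      ((z :* x″ :- x :* z″) :+ s) :+ ((z′ :* x″ :- x′ :* z″) :+ t)) refl z x z′ x′ z″ x″ _ _)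

  ω-·ˡ : ∀ {n} k (a v : Phase n) → ω (k · a) v ≈ k *ᴷ ω a v
  ω-·ˡ k []            []              = sym (zeroʳ k)
  ω-·ˡ k ((z , x) ∷ a) ((z′ , x′) ∷ v) = trans (+-congˡ (ω-·ˡ k a v))
    (solve 6 (λ k z x z′ x′ s → (k :* z :* x′ :- k :* x :* z′) :+ k :* s :=
      k :* ((z :* x′ :- x :* z′) :+ s)) refl k z x z′ x′ _)

  ω-⊖ˡ : ∀ {n} (a b v : Phase n) → ω (a ⊖ b) v ≈ ω a v - ω b v
  ω-⊖ˡ a b v = trans (ω-skew _ v) (trans (-‿cong (ω-⊖ v a b))
    (trans (solve 2 (λ p q → :- (p :- q) := :- p :- :- q) refl _ _)
    (+-cong (sym (ω-skew a v)) (-‿cong (sym (ω-skew b v))))))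

  ⊖-⊕ : ∀ {n} (v w : Phase n) → (v ⊖ w) ⊕ w ≋ v
  ⊖-⊕ []            []              = []
  ⊖-⊕ ((z , x) ∷ v) ((z′ , x′) ∷ w) = (e z z′ , e x x′) ∷ ⊖-⊕ v w
    where
    e : ∀ a b → (a - b) +ᴷ b ≈ a
    e = solve 2 (λ a b → (a :- b) :+ b := a) refl

  ⊕-++ : ∀ {n m} (u u′ : Phase n) (w w′ : Phase m) → (u ++ w) ⊕ (u′ ++ w′) ≋ (u ⊕ u′) ++ (w ⊕ w′)
  ⊕-++ []      []       w w′ = ≋-refl
  ⊕-++ (_ ∷ u) (_ ∷ u′) w w′ = (refl , refl) ∷ ⊕-++ u u′ w w′

  ⊖-++ : ∀ {n m} (u u′ : Phase n) (w w′ : Phase m) → (u ++ w) ⊖ (u′ ++ w′) ≋ (u ⊖ u′) ++ (w ⊖ w′)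
  ⊖-++ []      []       w w′ = ≋-refl
  ⊖-++ (_ ∷ u) (_ ∷ u′) w w′ = (refl , refl) ∷ ⊖-++ u u′ w w′

  ·-++ : ∀ {n m} k (u : Phase n) (w : Phase m) → k · (u ++ w) ≋ (k · u) ++ (k · w)
  ·-++ k []      w = ≋-refl
  ·-++ k (_ ∷ u) w = (refl , refl) ∷ ·-++ k u w

  𝟎-++ : ∀ n {m} → 𝟎 {n + m} ≋ 𝟎 {n} ++ 𝟎 {m}
  𝟎-++ zero    = ≋-refl
  𝟎-++ (suc n) = (refl , refl) ∷ 𝟎-++ n

  -- A record, since _++_ is not injective for unification.
  record Joint {n k m} (L : Relation n (k + m)) (v : Phase n) (u : Phase k) (w : Phase m) :
               Set (c ⊔ ℓ) where
    constructor joint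
    field holds-++ : holds L v (u ++ w)

  open Joint

  joint-resp : ∀ {n k m} {L : Relation n (k + m)} {v v′} {u u′ : Phase k} {w w′ : Phase m} →
               v ≋ v′ → u ≋ u′ → w ≋ w′ → Joint L v u w → Joint L v′ u′ w′
  joint-resp {L = L} e e′ e″ (joint h) = joint (resp L e (++⁺ e′ e″) h)

  joint-split : ∀ {n} k {m} {L : Relation n (k + m)} {v y} →
                holds L v y → Joint {k = k} L v (take k y) (drop k y)
  joint-split k {L = L} {y = y} h = joint (resp L ≋-refl (++-take-drop k y) h)

  joint-unsplit : ∀ {n} k {m} {L : Relation n (k + m)} {v y} →
                  Joint {k = k} L v (take k y) (drop k y) → holds L v y
  joint-unsplit k {L = L} {y = y} (joint h) = resp L ≋-refl (≋-sym (++-take-drop k y)) h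

  marginal : ∀ k {n m} → Relation n (k + m) → Relation n m
  marginal k L = record
    { holds = λ v w → Σ[ u ∈ Phase k ] Joint L v u w
    ; resp  = λ e e′ (u , h) → u , joint-resp e ≋-refl e′ h
    }

  isotropic-++ : ∀ {n k m} {L : Relation n (k + m)} → IsIsotropic L →
                 ∀ {v v′} {u u′ : Phase k} {w w′ : Phase m} →
                 Joint L v u w → Joint L v′ u′ w′ → ω v v′ ≈ ω u u′ +ᴷ ω w w′
  isotropic-++ {L = L} iso {v} {v′} {u} {u′} {w} {w′} (joint h) (joint h′) =
    trans (perp⁻ L v (u ++ w) (iso _ _ h) v′ (u′ ++ w′) h′) (ω-++-++ u u′ w w′)

  coisotropic-++ : ∀ {n k m} {L : Relation n (k + m)} → IsCoisotropic L →
                   ∀ v (u : Phase k) (w : Phase m) →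
                   (∀ v′ u′ w′ → Joint L v′ u′ w′ → ω v v′ ≈ ω u u′ +ᴷ ω w w′) →
                   Joint L v u w
  coisotropic-++ {k = k} {L = L} cois v u w h = joint (cois _ _ (perp⁺ L v (u ++ w) λ v′ y′ r →
    trans (h v′ (take k y′) (drop k y′) (joint-split k r))
    (trans (sym (ω-++-++ u (take k y′) w (drop k y′)))
    (ω-congʳ (u ++ w) (≋-sym (++-take-drop k y′))))))

  -- Purifications of relations, and the isometry between two of them.

  record RelPurification {p} (P : ∀ {n m} → Relation n m → Set p) {n m} (R : Relation n m) :
                      Set (Level.suc (c ⊔ ℓ) ⊔ p) where
    field
      k         : ℕ
      L         : Relation n (k + m)
      L∈P       : P L
      purifies  : marginal k L ≐ R
      universal : ∀ {l} (M : Relation n (l + m)) → P M → marginal l M ≐ R →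
                  Σ[ W ∈ Relation k l ] P W × (W †ᴿ ∘ᴿ W ≐ idᴿ k) × (M ≐ (W ⊗ᴿ idᴿ m) ∘ᴿ L)

  module Comparison {n m k l} {R : Relation n m} {L : Relation n (k + m)} {M : Relation n (l + m)}
                    (L-lagrangian : LinearLagrangian L) (M-lagrangian : LinearLagrangian M)
                    (L-marginal : marginal k L ≐ R) (M-marginal : marginal l M ≐ R)
                    (onto : ∀ (u : Phase k) → ∃[ v ] Σ[ w ∈ Phase m ] Joint L v u w) where
    private
      module L = IsLinear (proj₁ L-lagrangian)
      module M = IsLinear (proj₁ M-lagrangian)
      L⇒M : ∀ {v u w} → Joint L v u w → Σ[ u′ ∈ Phase l ] Joint M v u′ w
      L⇒M h = proj₂ M-marginal _ _ (proj₁ L-marginal _ _ (_ , h))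
      M⇒L : ∀ {v u w} → Joint M v u w → Σ[ u′ ∈ Phase k ] Joint L v u′ w
      M⇒L h = proj₂ L-marginal _ _ (proj₁ M-marginal _ _ (_ , h))
      isoL : ∀ {v v′} {u u′ : Phase k} {w w′ : Phase m} →
             Joint L v u w → Joint L v′ u′ w′ → ω v v′ ≈ ω u u′ +ᴷ ω w w′
      isoL = isotropic-++ {k = k} {L = L} (proj₁ (proj₂ L-lagrangian))
      isoM : ∀ {v v′} {u u′ : Phase l} {w w′ : Phase m} →
             Joint M v u w → Joint M v′ u′ w′ → ω v v′ ≈ ω u u′ +ᴷ ω w w′
      isoM = isotropic-++ {k = l} {L = M} (proj₁ (proj₂ M-lagrangian))
      coisM = coisotropic-++ {k = l} {L = M} (proj₂ (proj₂ M-lagrangian))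

    W : Relation k l
    W = record
      { holds = λ u u′ → ∃[ v ] Σ[ w ∈ Phase m ] Joint L v u w × Joint M v u′ w
      ; resp  = λ e e′ (v , w , h , h′) →
          v , w , joint-resp ≋-refl e ≋-refl h , joint-resp ≋-refl e′ ≋-refl h′
      }

    W-linear : IsLinear W
    W-linear = record
      { 𝟎-closed = 𝟎 , 𝟎 , joint (resp L ≋-refl (𝟎-++ k) L.𝟎-closed) ,
                   joint (resp M ≋-refl (𝟎-++ l) M.𝟎-closed)
      ; ⊕-closed = λ { {u₁} {u₂} {u₁′} {u₂′} (v₁ , w₁ , joint h₁ , joint h₁′) (v₂ , w₂ , joint h₂ , joint h₂′) →
          v₁ ⊕ v₂ , w₁ ⊕ w₂ , joint (resp L ≋-refl (⊕-++ u₁ u₂ w₁ w₂) (L.⊕-closed h₁ h₂)) ,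
          joint (resp M ≋-refl (⊕-++ u₁′ u₂′ w₁ w₂) (M.⊕-closed h₁′ h₂′)) }
      ; ·-closed = λ { μ {u} {u′} (v , w , joint h , joint h′) →
          μ · v , μ · w , joint (resp L ≋-refl (·-++ μ u w) (L.·-closed μ h)) ,
          joint (resp M ≋-refl (·-++ μ u′ w) (M.·-closed μ h′)) }
      }

    -- Isotropy of `L` and of `M` expands the same `ω v v₁` in two ways, with a common summand
    -- `ω w w₁` that cancels.
    W-isotropic : IsIsotropic W
    W-isotropic u u′ (v , w , h , h′) = perp⁺ W u u′ λ u₁ u₁′ (v₁ , w₁ , h₁ , h₁′) →
      +-cancelʳ _ _ _ (trans (sym (isoL h h₁)) (isoM h′ h₁′))

    -- `onto` supplies `(v , w)` for `u`, and coisotropy of `M` puts `(v , u′ , w)` into `M`: every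
    -- member of `M` to test against has a partner in `L` with the same `(v₁ , w₁)`, which gives a
    -- pair of `W`.
    W-coisotropic : IsCoisotropic W
    W-coisotropic u u′ perp = let (v , w , h) = onto u in
      v , w , h , coisM v u′ w λ v₁ u₁′ w₁ h₁′ →
        let (u₁ , h₁) = M⇒L h₁′ in
        trans (isoL h h₁) (+-congʳ (perp⁻ W u u′ perp u₁ u₁′ (v₁ , w₁ , h₁ , h₁′)))

    W-lagrangian : LinearLagrangian W
    W-lagrangian = W-linear , W-isotropic , W-coisotropic

    -- `W` preserves `ω` and, by `onto` and the equal marginals, is total. If `u` and `u₁` share an
    -- image, they therefore pair equally with every `u₂`, and nondegeneracy makes them equal.
    W-isometry : W †ᴿ ∘ᴿ W ≐ idᴿ k
    W-isometry =
      (λ u u₁ (u′ , (v , w , h , h′) , (v₁ , w₁ , h₁ , h₁′)) → ω-nondegenerate u u₁ λ u₂ →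
        let (v₂ , w₂ , h₂) = onto u₂
            (u₂′ , h₂′)    = L⇒M h₂
        in trans (+-cancelʳ _ _ _ (trans (sym (isoL h h₂)) (isoM h′ h₂′)))
                 (sym (+-cancelʳ _ _ _ (trans (sym (isoL h₁ h₂)) (isoM h₁′ h₂′))))) ,
      (λ u u₁ e →
        let (v , w , h) = onto u
            (u′ , h′)   = L⇒M h
        in u′ , (v , w , h , h′) , (v , w , joint-resp ≋-refl e ≋-refl h , h′))

    -- From left to right the equal marginals suffice. For the converse, the `(v₁ , w₁)` behind the
    -- pair of `W` may differ from `(v , w)`, so membership in `M` is obtained from coisotropy,
    -- replacing `ω u u₂` by `ω u′ u₂′`.
    factors : M ≐ (W ⊗ᴿ idᴿ m) ∘ᴿ L
    factors =
      (λ v y′ h →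
        let w            = drop l y′
            h′           = joint-split l h
            (u , h₁)     = M⇒L h′
        in u ++ w , holds-++ h₁ ,
           resp W (≋-sym (take-++ u w)) ≋-refl (v , w , h₁ , h′) , drop-++ u w) ,
      (λ v y′ (y , h , (v₁ , w₁ , h₁ , h₁′) , e) →
        joint-unsplit l (joint-resp ≋-refl ≋-refl e (coisM v (take l y′) (drop k y) λ v₂ u₂′ w₂ h₂′ →
          let (u₂ , h₂) = M⇒L h₂′
          in trans (isoL (joint-split k h) h₂)
               (+-congʳ (+-cancelʳ _ _ _ (trans (sym (isoL h₁ h₂)) (isoM h₁′ h₂′)))))))

  -- Purification of a linear coisotropic relation.

  module LinearPurification {n m} (R : Relation n m) (R-coisotropic : LinearCoisotropic R) where
    private
      module R₀ = IsLinear (proj₁ R-coisotropic)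
      X = Phase n × Phase m
      comb : Carrier → X → X → X
      comb μ (v , w) (v′ , w′) = v ⊕ μ · v′ , w ⊕ μ · w′
      B : X → X → Carrier
      B (v , w) (v′ , w′) = ω v v′ - ω w w′
      B-linˡ : ∀ y → Duality.IsFunctional em comb (λ x → B x y)
      B-linˡ (v , w) μ (a , b) (a′ , b′) =
        trans (+-cong (ω-linearˡ μ a a′ v) (-‿cong (ω-linearˡ μ b b′ w)))
        (solve 5 (λ p q r s k → (p :+ k :* q) :- (r :+ k :* s) := (p :- r) :+ k :* (q :- s)) refl _ _ _ _ μ)
      B-skew : ∀ x y → B x y ≈ - B y x
      B-skew (v , w) (v′ , w′) = trans (+-cong (ω-skew v v′) (-‿cong (ω-skew w w′)))
        (solve 2 (λ p q → :- p :- :- q := :- (p :- q)) refl _ _)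
      B-alt : ∀ x → B x x ≈ 0#
      B-alt (v , w) = trans (+-cong (ω-alternating v) (-‿cong (ω-alternating w)))
        (solve 0 (𝟘 :- 𝟘 := 𝟘) refl)
      B-𝟎 : ∀ {v w} y → v ≋ 𝟎 {n} → w ≋ 𝟎 {m} → B (v , w) y ≈ 0#
      B-𝟎 (v′ , w′) e e′ =
        trans (+-cong (trans (ω-cong e (≋-refl {x = v′})) (ω-𝟎ˡ v′))
                      (-‿cong (trans (ω-cong e′ (≋-refl {x = w′})) (ω-𝟎ˡ w′))))
        (solve 0 (𝟘 :- 𝟘 := 𝟘) refl)
      T : X → Set (c ⊔ ℓ)
      T (v , w) = holds R v w
      coords₁ = coordinates comb n proj₁ (λ _ _ _ → ≋-refl)
      coords₂ = coordinates comb m proj₂ (λ _ _ _ → ≋-refl)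
      -- A vector whose coordinates all vanish is zero and pairs to zero with everything, so the
      -- coordinates separate.
      red : Reduction comb B B-linˡ B-skew B-alt T
      red = reduction comb B B-linˡ B-skew B-alt (coords₁ ++ coords₂) T
        (λ μ r r′ → R₀.⊕-closed r (R₀.·-closed μ r′)) ((𝟎 , 𝟎) , R₀.𝟎-closed)
        λ { t t∈T vanish s _ → B-𝟎 s
          (coordinates-separate comb n proj₁ (λ _ _ _ → ≋-refl) (All.++ˡ⁻ coords₁ vanish))
          (coordinates-separate comb m proj₂ (λ _ _ _ → ≋-refl) (All.++ʳ⁻ coords₁ vanish)) }
    open Reduction red

    -- On R this says that u is the value of φ.  Phrased by its pairings it
    -- respects equality, which is not known of φ.
    Graph : X → Phase k → Set (c ⊔ ℓ)
    Graph x u = ∀ x′ → T x′ → ω u (φ x′) ≈ B x x′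

    L : Relation n (k + m)
    L = record
      { holds = λ v y → T (v , drop k y) × Graph (v , drop k y) (take k y)
      ; resp  = λ e e′ (r , g) → resp R e (drop-cong k e′) r , λ x′ x′∈T →
          trans (ω-cong (≋-sym (take-cong k e′)) ≋-refl) (trans (g x′ x′∈T)
            (+-cong (ω-cong e ≋-refl) (-‿cong (ω-cong (drop-cong k e′) ≋-refl))))
      }

    L⁺ : ∀ {v w} (u : Phase k) → T (v , w) → Graph (v , w) u → Joint L v u w
    L⁺ {v} {w} u r g = joint (resp R ≋-refl (≋-sym (drop-++ u w)) r , λ { x′@(v′ , w′) x′∈T →
      trans (ω-cong (take-++ u w) ≋-refl) (trans (g x′ x′∈T)
        (+-congˡ (-‿cong (ω-cong (≋-sym (drop-++ u w)) ≋-refl)))) })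

    graph-φ : ∀ {x} → T x → Graph x (φ x)
    graph-φ x∈T x′ x′∈T = φ-pres _ _ x∈T x′∈T

    L-onto : ∀ (u : Phase k) → ∃[ v ] Σ[ w ∈ Phase m ] Joint L v u w
    L-onto u = let ((v , w) , x∈T , e) = φ-onto u in
      v , w , L⁺ u x∈T λ x′ x′∈T → trans (ω-cong (≋-sym e) ≋-refl) (graph-φ x∈T x′ x′∈T)

    -- Since `φ` is onto, pairing with its values tests against every vector, and nondegeneracy
    -- applies.
    graph⇒φ : ∀ {x u} → T x → Graph x u → u ≋ φ x
    graph⇒φ {x} {u} x∈T g = ω-nondegenerate u (φ x) λ u′ → let (x′ , x′∈T , e) = φ-onto u′ in
      trans (ω-congʳ u (≋-sym e)) (trans (g x′ x′∈T)
      (trans (sym (graph-φ x∈T x′ x′∈T)) (ω-congʳ (φ x) e)))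

    L-linear : IsLinear L
    L-linear = record
      { 𝟎-closed = resp L ≋-refl (≋-sym (𝟎-++ k)) (holds-++ (L⁺ 𝟎 R₀.𝟎-closed
          λ x′ _ → trans (ω-𝟎ˡ (φ x′)) (sym (B-𝟎 x′ ≋-refl ≋-refl))))
      ; ⊕-closed = λ { {v} {v′} {y} {y′} (r , g) (r′ , g′) →
          resp L ≋-refl (≋-sym (≋-trans (⊕-cong (++-take-drop k y) (++-take-drop k y′))
                                        (⊕-++ (take k y) (take k y′) (drop k y) (drop k y′))))
            (holds-++ (L⁺ (take k y ⊕ take k y′) (R₀.⊕-closed r r′) λ { x@(a , b) x∈T →
              trans (ω-⊕ˡ (take k y) (take k y′) (φ x)) (trans (+-cong (g x x∈T) (g′ x x∈T))
              (trans (solve 4 (λ p q r s → (p :- q) :+ (r :- s) := (p :+ r) :- (q :+ s)) refl _ _ _ _)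
              (sym (+-cong (ω-⊕ˡ v v′ a) (-‿cong (ω-⊕ˡ (drop k y) (drop k y′) b)))))) })) }
      ; ·-closed = λ { μ {v} {y} (r , g) →
          resp L ≋-refl (≋-sym (≋-trans (·-cong μ (++-take-drop k y)) (·-++ μ (take k y) (drop k y))))
            (holds-++ (L⁺ (μ · take k y) (R₀.·-closed μ r) λ { x@(a , b) x∈T →
              trans (ω-·ˡ μ (take k y) (φ x)) (trans (*-congˡ (g x x∈T))
              (trans (solve 3 (λ k p q → k :* (p :- q) := k :* p :- k :* q) refl μ _ _)
              (sym (+-cong (ω-·ˡ μ v a) (-‿cong (ω-·ˡ μ (drop k y) b)))))) })) }
      }

    L-isotropic : IsIsotropic L
    L-isotropic v y (r , g) = perp⁺ L v y λ v′ y′ (r′ , g′) →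
      trans (solve 2 (λ p q → p := (p :- q) :+ q) refl (ω v v′) (ω (drop k y) (drop k y′)))
      (trans (+-congʳ (trans (sym (g _ r′)) (ω-congʳ (take k y) (≋-sym (graph⇒φ r′ g′)))))
      (sym (ω-split k y y′)))

    -- Testing against the members of `L` over `R` gives `graph`. Subtracting from `(v , w)` a
    -- preimage of `take k y` under `φ` then leaves a vector orthogonal to `R`, which lies in `R` by
    -- coisotropy; adding the preimage back shows that `(v , w)` is in `R`.
    L-coisotropic : IsCoisotropic L
    L-coisotropic v y perp =
      let ((v₀ , w₀) , r₀ , e) = φ-onto (take k y)
          w = drop k y
      in resp R (⊖-⊕ v v₀) (⊖-⊕ w w₀) (R₀.⊕-closed
           (proj₂ R-coisotropic (v ⊖ v₀) (w ⊖ w₀) λ v′ w′ r′ →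
             trans (+-cong (ω-⊖ˡ v v₀ v′) (-‿cong (ω-⊖ˡ w w₀ w′)))
             (trans (solve 4 (λ p q r s → (p :- q) :- (r :- s) := (p :- r) :- (q :- s)) refl _ _ _ _)
             (trans (+-congʳ (trans (sym (graph (v′ , w′) r′))
                (trans (ω-cong (≋-sym e) ≋-refl) (graph-φ r₀ (v′ , w′) r′))))
             (-‿inverseʳ _))))
           r₀) , graph
      where
      graph : Graph (v , drop k y) (take k y)
      graph x@(v′ , w′) x∈T =
        trans (solve 2 (λ p q → p := (p :+ q) :- q) refl _ (ω (drop k y) w′))
        (+-congʳ (sym (trans (perp⁻ L v y perp v′ (φ x ++ w′) (holds-++ (L⁺ (φ x) x∈T (graph-φ x∈T))))
          (ω-++ y (φ x) w′))))

    L-lagrangian : LinearLagrangian L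
    L-lagrangian = L-linear , L-isotropic , L-coisotropic

    L-marginal : marginal k L ≐ R
    L-marginal =
      (λ v w (u , joint (r , _)) → resp R ≋-refl (drop-++ u w) r) ,
      (λ v w r → φ (v , w) , L⁺ (φ (v , w)) r (graph-φ r))

    purification : RelPurification LinearLagrangian R
    purification = record
      { k = k ; L = L ; L∈P = L-lagrangian ; purifies = L-marginal
      ; universal = λ M M-lagrangian M-marginal →
          let open Comparison {R = R} {L} {M} L-lagrangian M-lagrangian L-marginal M-marginal L-onto
          in W , W-lagrangian , W-isometry , factors
      }

  -- Translates, and purification of nonempty affine relations.

  translate-cong : ∀ {n m} p q (R S : Relation n m) → R ≐ S → translate p q R ≐ translate p q S
  translate-cong p q _ _ (f , g) = (λ _ _ → f _ _) , (λ _ _ → g _ _)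

  translate-injective : ∀ {n m} p q {R S : Relation n m} → translate p q R ≐ translate p q S → R ≐ S
  translate-injective p q {R} {S} (f , g) = shifted {R} {S} f , shifted {S} {R} g
    where
    shifted : ∀ {R S : Relation _ _} → translate p q R ⊆ translate p q S → R ⊆ S
    shifted {R} {S} f v w r = resp S (⊕-⊖ v p) (⊕-⊖ w q)
      (f (v ⊕ p) (w ⊕ q) (resp R (≋-sym (⊕-⊖ v p)) (≋-sym (⊕-⊖ w q)) r))

  translate-id : ∀ {n} (p : Phase n) → translate p p (idᴿ n) ≐ idᴿ n
  translate-id p =
    (λ v w e → ≋-trans (≋-sym (⊖-⊕ v p)) (≋-trans (⊕-cong e ≋-refl) (⊖-⊕ w p))) ,
    (λ v w e → ⊖-cong e ≋-refl)

  translate-∘ : ∀ {n m k} p q r (S : Relation m k) (R : Relation n m) →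
                translate p r (S ∘ᴿ R) ≐ translate q r S ∘ᴿ translate p q R
  translate-∘ p q r S R =
    (λ u w (v , h , h′) → v ⊕ q , resp R ≋-refl (≋-sym (⊕-⊖ v q)) h , resp S (≋-sym (⊕-⊖ v q)) ≋-refl h′) ,
    (λ u w (v , h , h′) → v ⊖ q , h , h′)

  take-⊖ : ∀ n {m} (v : Phase (n + m)) (a : Phase n) (b : Phase m) → take n (v ⊖ (a ++ b)) ≋ take n v ⊖ a
  take-⊖ n v a b = ≋-trans (≋-reflexive (take-zipWith _ v (a ++ b))) (⊖-cong ≋-refl (take-++ a b))

  drop-⊖ : ∀ n {m} (v : Phase (n + m)) (a : Phase n) (b : Phase m) → drop n (v ⊖ (a ++ b)) ≋ drop n v ⊖ b
  drop-⊖ n v a b = ≋-trans (≋-reflexive (drop-zipWith {m = n} _ v (a ++ b))) (⊖-cong ≋-refl (drop-++ a b))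

  translate-⊗ : ∀ {n m n′ m′} p q p′ q′ (R : Relation n m) (S : Relation n′ m′) →
                translate (p ++ p′) (q ++ q′) (R ⊗ᴿ S) ≐ translate p q R ⊗ᴿ translate p′ q′ S
  translate-⊗ {n} {m} p q p′ q′ R S =
    (λ v w (r , s) → resp R (take-⊖ n v p p′) (take-⊖ m w q q′) r ,
                     resp S (drop-⊖ n v p p′) (drop-⊖ m w q q′) s) ,
    (λ v w (r , s) → resp R (≋-sym (take-⊖ n v p p′)) (≋-sym (take-⊖ m w q q′)) r ,
                     resp S (≋-sym (drop-⊖ n v p p′)) (≋-sym (drop-⊖ m w q q′)) s)

  marginal-cong : ∀ k {n m} {L M : Relation n (k + m)} → L ≐ M → marginal k L ≐ marginal k M
  marginal-cong k (f , g) = (λ v w (u , joint h) → u , joint (f v (u ++ w) h)) ,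
                            (λ v w (u , joint h) → u , joint (g v (u ++ w) h))

  marginal-translate : ∀ {k n m} p (a : Phase k) q (L : Relation n (k + m)) →
                       marginal k (translate p (a ++ q) L) ≐ translate p q (marginal k L)
  marginal-translate p a q L =
    (λ v w (u , joint h) → u ⊖ a , joint (resp L ≋-refl (⊖-++ u a w q) h)) ,
    (λ v w (u , joint h) → u ⊕ a , joint (resp L ≋-refl
      (≋-sym (≋-trans (⊖-++ (u ⊕ a) a w q) (++⁺ (⊕-⊖ u a) (≋-refl {x = w ⊖ q})))) h))

  ⊖-self : ∀ {n} (v : Phase n) → v ⊖ v ≋ 𝟎 {n}
  ⊖-self []            = []
  ⊖-self ((z , x) ∷ v) = (-‿inverseʳ z , -‿inverseʳ x) ∷ ⊖-self v

  -- As `(p , q)` is in `R`, a competitor `M` contains `(p , a ++ q)` for some `a`. Based there, it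
  -- is a translate of a linear purification `M₀` of `S`. The isometry from `L` to `M₀`, translated
  -- by `(𝟎 , a)`, leads from `L⁺` to `M`.
  translate-purification : ∀ {n m} {R S : Relation n m} p q → R ≐ translate p q S → IsLinear S →
                           RelPurification LinearLagrangian S → RelPurification AffineLagrangian R
  translate-purification {n} {m} {R} {S} p q R≐ S-linear pur = record
    { k = k
    ; L = L⁺
    ; L∈P = inj₂ (p , 𝟎 ++ q , L , L∈P , ≐-refl L⁺)
    ; purifies = begin
        marginal k L⁺                ≈⟨ marginal-translate p 𝟎 q L ⟩
        translate p q (marginal k L) ≈⟨ translate-cong p q (marginal k L) S purifies ⟩
        translate p q S              ≈⟨ R≐ ⟨
        R                            ∎
    ; universal = universal⁺
    }
    where
    open RelPurification pur
    L⁺ = translate p (𝟎 ++ q) L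
    base : holds R p q
    base = proj₂ R≐ p q (resp S (≋-sym (⊖-self p)) (≋-sym (⊖-self q)) (IsLinear.𝟎-closed S-linear))

    universal⁺ : ∀ {l} (M : Relation n (l + m)) → AffineLagrangian M → marginal l M ≐ R →
                 Σ[ W ∈ Relation k l ] AffineLagrangian W × (W †ᴿ ∘ᴿ W ≐ idᴿ k) ×
                                       (M ≐ (W ⊗ᴿ idᴿ m) ∘ᴿ L⁺)
    universal⁺ {l} M (inj₁ empty) (_ , g) =
      let (u , joint h) = g p q base in contradiction h (empty p (u ++ q))
    universal⁺ {l} M (inj₂ (p′ , y′ , M₀ , M₀∈P , M≐′)) M-marginal =
      let (a , joint h) = proj₂ M-marginal p q base
          M≐ = rebase em {R = M} {M₀} (proj₁ M₀∈P) M≐′ h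
          M₀-marginal = translate-injective p q {marginal l M₀} {S} (begin
            translate p q (marginal l M₀)            ≈⟨ marginal-translate p a q M₀ ⟨
            marginal l (translate p (a ++ q) M₀)     ≈⟨ marginal-cong l {L = M} {translate p (a ++ q) M₀} M≐ ⟨
            marginal l M                             ≈⟨ M-marginal ⟩
            R                                        ≈⟨ R≐ ⟩
            translate p q S                          ∎)
          (W , W∈P , isometry , factors) = universal M₀ M₀∈P M₀-marginal
          W⁺ = translate 𝟎 a W
      in W⁺ , inj₂ (𝟎 , a , W , W∈P , ≐-refl W⁺) ,
         (begin
           translate a 𝟎 (W †ᴿ) ∘ᴿ W⁺  ≈⟨ translate-∘ 𝟎 a 𝟎 (W †ᴿ) W ⟨
           translate 𝟎 𝟎 (W †ᴿ ∘ᴿ W)   ≈⟨ translate-cong 𝟎 𝟎 (W †ᴿ ∘ᴿ W) (idᴿ k) isometry ⟩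
           translate 𝟎 𝟎 (idᴿ k)       ≈⟨ translate-id 𝟎 ⟩
           idᴿ k                       ∎) ,
         (begin
           M
             ≈⟨ M≐ ⟩
           translate p (a ++ q) M₀
             ≈⟨ translate-cong p (a ++ q) M₀ ((W ⊗ᴿ idᴿ m) ∘ᴿ L) factors ⟩
           translate p (a ++ q) ((W ⊗ᴿ idᴿ m) ∘ᴿ L)
             ≈⟨ translate-∘ p (𝟎 ++ q) (a ++ q) (W ⊗ᴿ idᴿ m) L ⟩
           translate (𝟎 ++ q) (a ++ q) (W ⊗ᴿ idᴿ m) ∘ᴿ L⁺
             ≈⟨ Rel.∘-cong {f = translate (𝟎 ++ q) (a ++ q) (W ⊗ᴿ idᴿ m)} {W⁺ ⊗ᴿ translate q q (idᴿ m)}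
                  {L⁺} {L⁺} (translate-⊗ 𝟎 a q q W (idᴿ m)) (≐-refl L⁺) ⟩
           (W⁺ ⊗ᴿ translate q q (idᴿ m)) ∘ᴿ L⁺
             ≈⟨ Rel.∘-cong {f = W⁺ ⊗ᴿ translate q q (idᴿ m)} {W⁺ ⊗ᴿ idᴿ m} {L⁺} {L⁺}
                  (Rel.⊗-cong {f = W⁺} {W⁺} {translate q q (idᴿ m)} {idᴿ m} (≐-refl W⁺) (translate-id q))
                  (≐-refl L⁺) ⟩
           (W⁺ ⊗ᴿ idᴿ m) ∘ᴿ L⁺ ∎)

  -- Lagrangian states, and purification of empty relations.

  positionᴿ : Relation 0 1
  positionᴿ = record
    { holds = λ _ w → ∃[ x ] w ≋ (0# , x) ∷ []
    ; resp  = λ _ e (x , h) → x , ≋-trans (≋-sym e) h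
    }

  position-lagrangian : LinearLagrangian positionᴿ
  position-lagrangian =
    record
      { 𝟎-closed = 0# , ≋-refl
      ; ⊕-closed = λ { {w = _ ∷ []} {_ ∷ []} (x , (p , q) ∷ []) (x′ , (p′ , q′) ∷ []) →
          x +ᴷ x′ , (trans (+-cong p p′) (+-identityˡ 0#) , +-cong q q′) ∷ [] }
      ; ·-closed = λ { μ {w = _ ∷ []} (x , (p , q) ∷ []) →
          μ *ᴷ x , (trans (*-congˡ p) (zeroʳ μ) , *-congˡ q) ∷ [] }
      } ,
    (λ { [] w (x , e) → perp⁺ positionᴿ [] w λ { [] w′ (x′ , e′) →
      sym (trans (ω-cong e e′) (solve 2 (λ x x′ → (𝟘 :* x′ :- x :* 𝟘) :+ 𝟘 := 𝟘) refl x x′)) } }) ,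
    -- Pairing with the member `(0 , 1)` of the line reads off `z`.
    (λ { [] ((z , x) ∷ []) h → x ,
      (trans (solve 2 (λ z x → z := (z :* 𝟙 :- x :* 𝟘) :+ 𝟘) refl z x)
        (sym (perp⁻ positionᴿ [] ((z , x) ∷ []) h [] ((0# , 1#) ∷ []) (1# , ≋-refl))) , refl) ∷ [] })

  positions : ∀ k → Relation 0 k
  positions zero    = idᴿ 0
  positions (suc k) = positionᴿ ⊗ᴿ positions k

  positions-lagrangian : ∀ k → LinearLagrangian (positions k)
  positions-lagrangian zero    = IsSubPROP.id-closed (lagrangian-closed em) 0
  positions-lagrangian (suc k) =
    IsSubPROP.⊗-closed (lagrangian-closed em) {f = positionᴿ} position-lagrangian (positions-lagrangian k)

  -- A competitor with empty marginal is empty, so it factors through any `W`. A state `0 → l` is an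
  -- isometry once it is inhabited, K⁰ being a point; `positions l` contains zero.
  empty-purification : ∀ {n m} {R : Relation n m} → IsEmpty R → RelPurification AffineLagrangian R
  empty-purification {m = m} {R} empty = record
    { k = 0
    ; L = R
    ; L∈P = inj₁ empty
    ; purifies = (λ { v w ([] , joint h) → h }) , (λ v w h → [] , joint h)
    ; universal = λ {l} M _ (f , _) →
        positions l , Linear⇒Affine {LinearLagrangian} (positions-lagrangian l) ,
        ((λ { [] [] _ → [] }) , λ { [] [] _ → 𝟎 , 𝟎∈ l , 𝟎∈ l }) ,
        (λ v y h → contradiction (f v (drop l y) (_ , joint-split l h)) (empty v (drop l y))) ,
        (λ { v y (y′ , h , _) → contradiction h (empty v y′) })
    }
    where
    𝟎∈ : ∀ l → holds (positions l) [] 𝟎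
    𝟎∈ l = IsLinear.𝟎-closed (proj₁ (positions-lagrangian l))

  linearPurification : ∀ {n m} (R : Relation n m) → LinearCoisotropic R → RelPurification LinearLagrangian R
  linearPurification = LinearPurification.purification

  affinePurification : ∀ {n m} (R : Relation n m) → AffineCoisotropic R → RelPurification AffineLagrangian R
  affinePurification R (inj₁ empty) = empty-purification empty
  affinePurification R (inj₂ (p , q , S , S-coisotropic , R≐)) =
    translate-purification {R = R} {S} p q R≐ (proj₁ S-coisotropic) (linearPurification S S-coisotropic)

  -- Discarding in relations, for the linear and the affine case at once.

  module DiscardCompletion {a b}
    (P : ∀ {n m} → Relation n m → Set a) (P-closed : IsSubPROP RelPROP P)
    (Q : ∀ {n m} → Relation n m → Set b) (Q-closed : IsSubPROP RelPROP Q)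
    (P⇒Q : ∀ {n m} {R : Relation n m} → P R → Q R) (discard∈Q : Q discardᴿ)
    (purify : ∀ {n m} (R : Relation n m) → Q R → RelPurification P R) where

    Pure = SubPROP RelPROP P P-closed
    Mixed = DaggerCompactPROP.prop (SubPROP RelPROP Q Q-closed)

    inclusion : PROPMorphism (DaggerCompactPROP.prop Pure) Mixed
    inclusion = record
      { map-hom  = λ (R , r) → R , P⇒Q r
      ; map-cong = λ e → e
      ; map-id   = λ n → ≐-refl (idᴿ n)
      ; map-∘    = λ (S , _) (R , _) → ≐-refl (S ∘ᴿ R)
      ; map-⊗    = λ (R , _) (S , _) → ≐-refl (R ⊗ᴿ S)
      ; map-σ    = λ n m → ≐-refl (σᴿ n m)
      }

    open Extension Pure Mixed inclusion (discardᴿ , discard∈Q)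
    open NormalForm Pure using (purge)
    open Discard Pure using (d^⊗)

    d^⊗-full : ∀ k v w → holds (proj₁ (eval (d^⊗ k))) v w
    d^⊗-full zero    [] [] = []
    d^⊗-full (suc k) v  w  = _ , d^⊗-full k _ w

    -- The diagonal is contained in the composite of `H` with its converse, so `H` is total;
    -- discarding relates everything.
    eval-discard : ∀ {n m} (H : Σ (Relation n m) P) → proj₁ H †ᴿ ∘ᴿ proj₁ H ≐ idᴿ n →
                   proj₁ (eval (d^⊗ m)) ∘ᴿ proj₁ H ≐ proj₁ (eval (d^⊗ n))
    eval-discard {n} {m} H (_ , g) =
      (λ v w _ → d^⊗-full n v w) ,
      (λ v w _ → let (u , h , _) = g v v ≋-refl in u , h , d^⊗-full m u w)

    -- Discarding is the full relation, so composing with it amounts to an existential quantifier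
    -- over the first `k` outputs.
    eval-purge : ∀ k {n m} (L : Σ (Relation n (k + m)) P) →
                 proj₁ (eval (Discard._∘_ (purge k m) (arr L))) ≐ marginal k (proj₁ L)
    eval-purge k {n} {m} (L , _) =
      (λ v w (y , h , _ , e) → take k y , joint-resp ≋-refl ≋-refl e (joint-split k h)) ,
      (λ v w (u , joint h) → u ++ w , h , d^⊗-full k _ _ , drop-++ u w)

    purification : ∀ {n m} (R : Σ (Relation n m) Q) → Purification eval-discard R
    purification {n} {m} (R , r) = record
      { k = k
      ; L = L , L∈P
      ; purifies = begin
          proj₁ (eval (Discard._∘_ (purge k m) (arr (L , L∈P)))) ≈⟨ eval-purge k (L , L∈P) ⟩
          marginal k L                                           ≈⟨ purifies ⟩
          R                                                      ∎
      ; universal = λ { {l} (M , M∈P) e →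
          let (W , W∈P , isometry , factors) = universal M M∈P (begin
                marginal l M                                           ≈⟨ eval-purge l (M , M∈P) ⟨
                proj₁ (eval (Discard._∘_ (purge l m) (arr (M , M∈P)))) ≈⟨ e ⟩
                R                                                      ∎)
          in (W , W∈P) , isometry , factors }
      }
      where open RelPurification (purify R r)

mainTheorem3 : ∀ {c ℓ} (em : ExcludedMiddle (c ⊔ ℓ)) (K : Field c ℓ) →
    let open Relations em K in
    (Σ[ F ∈ PROPMorphism (Disc ALR) ACR.prop ]
    (∀ {n m} (R : ALR.Hom n m) → PROPMorphism.map-hom F (arr R) ACR.≈ ALR⊆ACR R) ×
    (PROPMorphism.map-hom F d ACR.≈ discardᵃ) ×
    IsIsomorphism F) ×
    (Σ[ F ∈ PROPMorphism (Disc LR) CR.prop ]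
    (∀ {n m} (R : LR.Hom n m) → PROPMorphism.map-hom F (arr R) CR.≈ LR⊆CR R) ×
    (PROPMorphism.map-hom F d CR.≈ discardᶜ) ×
    IsIsomorphism F)
-- The props are left to unification: checking Disc C against a Disc C′ that
-- is not syntactically equal to it unfolds all the laws of both.
mainTheorem3 em K =
  (Extension.extension _ _ A.inclusion discardᵃ A.eval-discard ,
   (λ (R , _) → ≐-refl R) , ≐-refl discardᴿ ,
   Extension.extension-isomorphism _ _ _ _ _ A.purification) ,
  (Extension.extension _ _ L.inclusion discardᶜ L.eval-discard ,
   (λ (R , _) → ≐-refl R) , ≐-refl discardᴿ ,
   Extension.extension-isomorphism _ _ _ _ _ L.purification)
  where
  open PhaseSpace K
  open Purifications em K
  open Relations em K using (discardᵃ; discardᶜ)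
  module A = DiscardCompletion
    AffineLagrangian (affine-closed em LinearLagrangian proj₁ (lagrangian-closed em))
    AffineCoisotropic (affine-closed em LinearCoisotropic proj₁ (coisotropic-closed em))
    (λ {_} {_} {R} → Affine-map {LinearLagrangian} {LinearCoisotropic} Lagrangian⇒Coisotropic {R = R})
    (Linear⇒Affine {LinearCoisotropic} discard-coisotropic) affinePurification
  module L = DiscardCompletion
    LinearLagrangian (lagrangian-closed em) LinearCoisotropic (coisotropic-closed em)
    Lagrangian⇒Coisotropic discard-coisotropic linearPurification
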